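{- The following statements hold. (i) For every $D\ge 3$, the set of infinite graphs with a one-way infinite bridge is neither meager nor comeager in $\mathfrak{G}^{\infty}_{\le D}$. (ii) For every $D\ge 3$, the set of infinite graphs with a two-way infinite bridge is neither meager nor comeager in $\mathfrak{G}^{\infty}_{\le D}$. (iii) For every $D\ge 4$, the set of infinite bridgeless graphs is neither meager nor comeager in $\mathfrak{G}^{\infty}_{\le D}$.
   Context: Graphs are simple. $\mathfrak{G}^{\infty}_{\le D}$ is the set of connected infinite graphs of maximum degree at most $D$, up to isomorphism. For a graph $G$ and $r\ge 0$, $B_r(G,v)$ is the subgraph induced by the vertices at distance at most $r$ from $v$, rooted at $v$, and $\mathfrak{B}_r(G)=\{B_r(G,v): v\in V(G)\}$, a set of rooted graphs up to root-preserving isomorphism (multiplicities ignored). $\mathfrak{G}^{\infty}_{\le D}$ carries the topology of the pseudometric $d(G_1,G_2)=\inf\{2^{ -r}: \mathfrak{B}_r(G_1)=\mathfrak{B}_r(G_2)\}$. A subset $S$ of a space $X$ is nowhere dense in $X$ if every non-empty open $U\subseteq X$ contains a non-empty open $U'\subseteq U$ with $U'\cap S=\emptyset$; meager if it is a countable union of nowhere dense sets; comeager if its complement is meager. An edge $e$ of an infinite connected graph $G$ is a bridge if $G-e$ is disconnected. A bridge is two-way infinite if both components of $G-e$ are infinite, and one-way infinite otherwise. A graph is bridgeless if it has no bridge. -}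

module Defs where

open import Data.Fin.Base using (Fin)
open import Data.Irrelevant using ([_])
open import Data.Nat.Base using (ℕ; zero; suc; _≤_; z≤n)
open import Data.Product.Base using (Σ; ∃-syntax; _×_; _,_)
open import Data.Rational.Base using (ℚ; 0ℚ; 1ℚ; ½) renaming (_<_ to _<ℚ_; _*_ to _*ℚ_)
open import Data.Refinement using (Refinement-syntax; value)
  renaming (_,_ to _∣ᵣ_)
open import Data.Refinement.Properties using (value-injective)
open import Data.Sum.Base using (_⊎_; inj₁; inj₂)
import Data.Sum.Base as Sum
open import Function.Base using (_∘_)
open import Function.Bundles using (_↔_; mk↔ₛ′; module Inverse)
import Function.Construct.Composition as Comp
import Function.Construct.Identity as Id
import Function.Construct.Symmetry as Symm
open import Level using (0ℓ; _⊔_) renaming (suc to lsuc)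
open import Relation.Binary.Bundles using (Setoid)
open import Relation.Binary.Core using (Rel)
open import Relation.Binary.Definitions using (Symmetric; Irreflexive; _Respects_)
open import Relation.Binary.PropositionalEquality
  using (_≡_; refl; sym; trans; cong; subst; subst₂)
open import Relation.Nullary.Negation using (¬_)
open import Relation.Unary
  using (Pred; _⊆_; _∩_; ∁; ⋃; _≐_; Satisfiable; Empty)

Finite : Set → Set
Finite A = ∃[ n ] (A ↔ Fin n)

Infinite : Set → Set
Infinite A = ¬ Finite A

-- Only whether x ~ y is inhabited matters, so there are no multiple edges.
record Graph : Set₁ where
  infix 4 _~_
  field
    V      : Set
    _~_    : Rel V 0ℓ
    ~-sym  : Symmetric _~_
    ~-irr  : Irreflexive _≡_ _~_

open Graph using (V)

_[_~_] : (G : Graph) → V G → V G → Set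
G [ x ~ y ] = Graph._~_ G x y

record _≅_ (G H : Graph) : Set where
  field
    bij       : V G ↔ V H
  open Inverse bij public using (to; from; strictlyInverseˡ; strictlyInverseʳ)
  field
    preserves : ∀ {x y} → G [ x ~ y ] → H [ to x ~ to y ]
    reflects  : ∀ {x y} → H [ to x ~ to y ] → G [ x ~ y ]

infix 4 _≅_

≅-refl : ∀ {G} → G ≅ G
≅-refl = record { bij = Id.↔-id _ ; preserves = λ e → e ; reflects = λ e → e }

≅-sym : ∀ {G H} → G ≅ H → H ≅ G
≅-sym {G} {H} φ = record
  { bij       = Symm.↔-sym bij
  ; preserves = λ e → reflects
      (subst₂ (H [_~_]) (sym (strictlyInverseˡ _)) (sym (strictlyInverseˡ _)) e)
  ; reflects  = λ e →
      subst₂ (H [_~_]) (strictlyInverseˡ _) (strictlyInverseˡ _) (preserves e)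
  }
  where open _≅_ φ

≅-trans : ∀ {G H K} → G ≅ H → H ≅ K → G ≅ K
≅-trans φ ψ = record
  { bij       = _≅_.bij ψ Comp.↔-∘ _≅_.bij φ
  ; preserves = _≅_.preserves ψ ∘ _≅_.preserves φ
  ; reflects  = _≅_.reflects φ ∘ _≅_.reflects ψ
  }

-- Induced subgraph.  The membership proofs in a refinement type are irrelevant,
-- so each vertex satisfying P is counted exactly once.
induced : (G : Graph) → Pred (V G) 0ℓ → Graph
induced G P = record
  { V     = [ x ∈ V G ∣ P x ]
  ; _~_   = λ x y → G [ value x ~ value y ]
  ; ~-sym = Graph.~-sym G
  ; ~-irr = λ x≡y → Graph.~-irr G (cong value x≡y)
  }

data Walk (G : Graph) : ℕ → V G → V G → Set where
  []  : ∀ {x} → Walk G zero x x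
  _∷_ : ∀ {n x y z} → G [ x ~ y ] → Walk G n y z → Walk G (suc n) x z

Reachable : (G : Graph) → V G → V G → Set
Reachable G x y = ∃[ n ] Walk G n x y

Connected : Graph → Set
Connected G = ∀ x y → Reachable G x y

Component : (G : Graph) → V G → Set
Component G x = [ y ∈ V G ∣ Reachable G x y ]

AllComponentsInfinite : Pred Graph 0ℓ
AllComponentsInfinite G = ∀ x → Infinite (Component G x)

MaxDegree≤ : ℕ → Graph → Set
MaxDegree≤ D G = ∀ v → ∃[ d ] (d ≤ D × ([ w ∈ V G ∣ G [ v ~ w ] ] ↔ Fin d))

record RootedGraph : Set₁ where
  field
    graph : Graph
    root  : V graph

open RootedGraph

_≅ᵣ_ : RootedGraph → RootedGraph → Set
A ≅ᵣ B = Σ (graph A ≅ graph B) λ φ → _≅_.to φ (root A) ≡ root B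

DistanceAtMost : (G : Graph) → ℕ → V G → V G → Set
DistanceAtMost G r v x = ∃[ n ] (n ≤ r × Walk G n v x)

Ball : ℕ → (G : Graph) → V G → RootedGraph
Ball r G v = record
  { graph = induced G (DistanceAtMost G r v)
  ; root  = v ∣ᵣ [ (zero , z≤n , []) ]
  }

𝔅 : ℕ → Graph → Pred RootedGraph 0ℓ
𝔅 r G B = ∃[ v ] (B ≅ᵣ Ball r G v)

-- Points are taken up to the equality of a setoid, so subsets have
-- to respect it.  Small predicates suffice: under excluded middle every predicate
-- is equivalent to one valued in Set.
record Subset {c ℓ} (X : Setoid c ℓ) : Set (c ⊔ ℓ ⊔ lsuc 0ℓ) where
  open Setoid X using (Carrier; _≈_)
  field
    mem  : Pred Carrier 0ℓ
    resp : mem Respects _≈_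

open Subset using (mem)

complement : ∀ {c ℓ} {X : Setoid c ℓ} → Subset X → Subset X
complement {X = X} S = record
  { mem  = ∁ (mem S)
  ; resp = λ x≈y x∉S y∈S → x∉S (Subset.resp S (Setoid.sym X x≈y) y∈S)
  }

module BaireCategory {c ℓ o} (X : Setoid c ℓ) (Open : Pred (Subset X) o) where

  NowhereDense : Subset X → Set (c ⊔ ℓ ⊔ o ⊔ lsuc 0ℓ)
  NowhereDense S =
    ∀ (U : Subset X) → Open U → Satisfiable (mem U) →
    ∃[ U′ ] (Open U′ × Satisfiable (mem U′) × mem U′ ⊆ mem U × Empty (mem U′ ∩ mem S))

  Meager : Subset X → Set (c ⊔ ℓ ⊔ o ⊔ lsuc 0ℓ)
  Meager S = Σ (ℕ → Subset X) λ N →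
    (∀ n → NowhereDense (N n)) × mem S ≐ ⋃ ℕ (λ n → mem (N n))

  Comeager : Subset X → Set (c ⊔ ℓ ⊔ o ⊔ lsuc 0ℓ)
  Comeager S = Meager (complement S)

record InfiniteGraph (D : ℕ) : Set₁ where
  field
    graph     : Graph
    connected : Connected graph
    infinite  : Infinite (V graph)
    maxDegree : MaxDegree≤ D graph

⌊_⌋ : ∀ {D} → InfiniteGraph D → Graph
⌊_⌋ = InfiniteGraph.graph

𝔊∞≤ : ℕ → Setoid (lsuc 0ℓ) 0ℓ
𝔊∞≤ D = record
  { Carrier       = InfiniteGraph D
  ; _≈_           = λ G H → ⌊ G ⌋ ≅ ⌊ H ⌋
  ; isEquivalence = record { refl = ≅-refl ; sym = ≅-sym ; trans = ≅-trans }
  }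

2^-_ : ℕ → ℚ
2^- zero  = 1ℚ
2^- suc r = ½ *ℚ (2^- r)

-- "d(G , H) < ε" for the pseudometric d(G , H) = inf { 2^-r : 𝔅 r G = 𝔅 r H }:
-- an infimum is below ε exactly when some element of the set is.
-- It suffices to let ε range over the rationals.
d[_,_]<_ : ∀ {D} → InfiniteGraph D → InfiniteGraph D → ℚ → Set₁
d[ G , H ]< ε = ∃[ r ] ((2^- r) <ℚ ε × 𝔅 r ⌊ G ⌋ ≐ 𝔅 r ⌊ H ⌋)

Open : ∀ {D} → Pred (Subset (𝔊∞≤ D)) (lsuc 0ℓ)
Open U = ∀ G → mem U G → ∃[ ε ] (0ℚ <ℚ ε × (∀ H → d[ G , H ]< ε → mem U H))

module _ {D : ℕ} where
  open BaireCategory (𝔊∞≤ D) Open public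

record Edge (G : Graph) : Set where
  field
    src tgt : V G
    adj     : G [ src ~ tgt ]

-- An edge is unordered, so it is given here with either of its two orientations.
Joins : ∀ {G} → Edge G → V G → V G → Set
Joins e x y = (x ≡ src × y ≡ tgt) ⊎ (x ≡ tgt × y ≡ src)
  where open Edge e

infixl 6 _-ₑ_
_-ₑ_ : (G : Graph) → Edge G → Graph
G -ₑ e = record
  { V     = V G
  ; _~_   = λ x y → G [ x ~ y ] × ¬ Joins e x y
  ; ~-sym = λ (xy , ¬e) → Graph.~-sym G xy , λ where
      (inj₁ (p , q)) → ¬e (inj₂ (q , p))
      (inj₂ (p , q)) → ¬e (inj₁ (q , p))
  ; ~-irr = λ x≡y (xy , _) → Graph.~-irr G x≡y xy
  }

IsBridge : (G : Graph) → Edge G → Set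
IsBridge G e = ¬ Connected (G -ₑ e)

IsTwoWayInfiniteBridge : (G : Graph) → Edge G → Set
IsTwoWayInfiniteBridge G e = IsBridge G e × AllComponentsInfinite (G -ₑ e)

IsOneWayInfiniteBridge : (G : Graph) → Edge G → Set
IsOneWayInfiniteBridge G e = IsBridge G e × ¬ IsTwoWayInfiniteBridge G e

HasTwoWayInfiniteBridge HasOneWayInfiniteBridge Bridgeless : Graph → Set
HasTwoWayInfiniteBridge G = ∃[ e ] IsTwoWayInfiniteBridge G e
HasOneWayInfiniteBridge G = ∃[ e ] IsOneWayInfiniteBridge G e
Bridgeless G = ¬ (∃[ e ] IsBridge G e)

mapWalk : ∀ {G H} (φ : G ≅ H) → ∀ {n x y} →
          Walk G n x y → Walk H n (_≅_.to φ x) (_≅_.to φ y)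
mapWalk φ []      = []
mapWalk φ (e ∷ w) = _≅_.preserves φ e ∷ mapWalk φ w

mapReachable : ∀ {G H} (φ : G ≅ H) → ∀ {x y} →
               Reachable G x y → Reachable H (_≅_.to φ x) (_≅_.to φ y)
mapReachable φ (n , w) = n , mapWalk φ w

connected-resp : Connected Respects _≅_
connected-resp {y = H} φ conn x y =
  subst₂ (Reachable H) (strictlyInverseˡ x) (strictlyInverseˡ y)
    (mapReachable φ (conn (from x) (from y)))
  where open _≅_ φ

component-↔ : ∀ {G H} (φ : G ≅ H) x → Component G x ↔ Component H (_≅_.to φ x)
component-↔ {G} {H} φ x = mk↔ₛ′
  (λ (y ∣ᵣ [ r ]) → to y ∣ᵣ [ mapReachable φ r ])
  (λ (y ∣ᵣ [ r ]) → from y ∣ᵣ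
    [ subst (λ z → Reachable G z (from y)) (strictlyInverseʳ x) (mapReachable (≅-sym φ) r) ])
  (λ y → value-injective (strictlyInverseˡ (value y)))
  (λ y → value-injective (strictlyInverseʳ (value y)))
  where open _≅_ φ

allComponentsInfinite-resp : AllComponentsInfinite Respects _≅_
allComponentsInfinite-resp {y = H} φ inf y =
  subst (Infinite ∘ Component H) (strictlyInverseˡ y)
    λ (n , b) → inf (from y) (n , b Comp.↔-∘ component-↔ φ (from y))
  where open _≅_ φ

module _ {G H : Graph} (φ : G ≅ H) where
  open _≅_ φ

  private
    to-injective : ∀ {x y} → to x ≡ to y → x ≡ y
    to-injective p =
      trans (sym (strictlyInverseʳ _)) (trans (cong from p) (strictlyInverseʳ _))

  mapEdge : Edge G → Edge H
  mapEdge e = record { src = to src ; tgt = to tgt ; adj = preserves adj }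
    where open Edge e

  delete-≅ : ∀ e → (G -ₑ e) ≅ (H -ₑ mapEdge e)
  delete-≅ e = record
    { bij       = bij
    ; preserves = λ (xy , ¬e) → preserves xy , ¬e ∘ Sum.map
        (λ (p , q) → to-injective p , to-injective q)
        (λ (p , q) → to-injective p , to-injective q)
    ; reflects  = λ (xy , ¬e) → reflects xy , ¬e ∘ Sum.map
        (λ (p , q) → cong to p , cong to q)
        (λ (p , q) → cong to p , cong to q)
    }

  isBridge-map : ∀ e → IsBridge G e → IsBridge H (mapEdge e)
  isBridge-map e b = b ∘ connected-resp (≅-sym (delete-≅ e))

  isTwoWay-map : ∀ e → IsTwoWayInfiniteBridge G e → IsTwoWayInfiniteBridge H (mapEdge e)
  isTwoWay-map e (b , inf) =
    isBridge-map e b , allComponentsInfinite-resp (delete-≅ e) inf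

  isOneWay-map : ∀ e → IsOneWayInfiniteBridge G e → IsOneWayInfiniteBridge H (mapEdge e)
  isOneWay-map e (b , ¬two) =
    isBridge-map e b , λ (_ , inf) →
      ¬two (b , allComponentsInfinite-resp (≅-sym (delete-≅ e)) inf)

oneWayInfiniteBridgeGraphs twoWayInfiniteBridgeGraphs bridgelessGraphs :
  ∀ D → Subset (𝔊∞≤ D)

oneWayInfiniteBridgeGraphs D = record
  { mem  = λ G → HasOneWayInfiniteBridge ⌊ G ⌋
  ; resp = λ φ (e , h) → mapEdge φ e , isOneWay-map φ e h
  }

twoWayInfiniteBridgeGraphs D = record
  { mem  = λ G → HasTwoWayInfiniteBridge ⌊ G ⌋
  ; resp = λ φ (e , h) → mapEdge φ e , isTwoWay-map φ e h
  }

bridgelessGraphs D = record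
  { mem  = λ G → Bridgeless ⌊ G ⌋
  ; resp = λ φ ¬b (e , h) →
      ¬b (mapEdge (≅-sym φ) e , isBridge-map (≅-sym φ) e h)
  }

{-# OPTIONS --safe #-}
module Submission where

-- If every infinite connected H whose r-balls all occur in G is isomorphic to G,
-- then the isomorphism class of G is open and has no proper non-empty open
-- subset, so no set containing G is meager.  Two such isolated graphs of maximum
-- degree 3 decide all cases: the comb (a two-way infinite path with a leaf at each
-- vertex) has bridges of both kinds, and the two-way infinite ladder has none.
--
-- To see that they are isolated, recognise inside H, from its 3-balls alone, the
-- edges of the path or the rails of the ladder.  Following such edges from a
-- starting edge gives a map ℤ → H that extends to a covering of H.  If the map
-- repeats a vertex (or hits both ends of a rung), it cannot have turned around,
-- hence it is periodic and H is finite.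

open import Defs
open import Axiom.ExcludedMiddle using (ExcludedMiddle)
open import Data.Bool.Base using (Bool; true; false; not)
open import Data.Bool.Properties using (¬-not; not-¬)
open import Data.Empty using (⊥-elim)
open import Data.Fin.Base as Fin using (Fin; toℕ)
open import Data.Fin.Properties using (injective⇒≤; toℕ-injective)
open import Data.Integer.Base using (ℤ; +_; -[1+_]; pred; _-_) renaming (suc to sucℤ; _<_ to _<ℤ_; _+_ to _+ℤ_; -_ to -ℤ_)
import Data.Integer.Properties as ℤ
import Data.List.Relation.Unary.All as All
open import Data.List.Relation.Unary.AllPairs using (_∷_)
open import Data.Nat.Properties using (_≤?_; _<?_)
open import Data.Rational.Base using (0ℚ) renaming (_<_ to _<ℚ_)
import Data.Rational.Properties as ℚ
open import Data.Irrelevant using ([_])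
open import Data.List.Base using (List; []; _∷_; _++_; length; lookup; map; upTo; deduplicate)
open import Data.List.Membership.Propositional using (_∈_)
open import Data.List.Membership.Propositional.Properties
  using (∈-deduplicate⁺; ∈-map⁺; ∈-upTo⁺; ∈-++⁺ˡ; ∈-++⁺ʳ; ∈-lookup)
open import Data.List.Properties using (length-deduplicate)
open import Data.List.Relation.Unary.Any using (index; here; there)
open import Data.List.Relation.Unary.Any.Properties using (lookup-index)
open import Data.List.Relation.Unary.Unique.Propositional using (Unique)
open import Data.List.Relation.Unary.Unique.DecPropositional.Properties using (deduplicate-!)
open import Data.Nat.Base using (ℕ; zero; suc; _≤_; _≥_; z≤n; s≤s)
import Data.Nat.Properties as ℕ
open import Data.Product.Base using (Σ; ∃-syntax; _×_; _,_; proj₁; proj₂; swap)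
open import Data.Refinement using (Refinement-syntax; value) renaming (_,_ to _∣ᵣ_)
open import Data.Refinement.Properties using (value-injective)
open import Data.Sum.Base using (_⊎_; inj₁; inj₂)
open import Function.Base using (_∘_; case_of_)
open import Function.Bundles using (_↔_; mk↔ₛ′; module Inverse)
open import Level using (0ℓ)
open import Relation.Binary.Core using (Rel)
open import Relation.Binary.Definitions using (Symmetric)
open import Relation.Binary.PropositionalEquality
  using (_≡_; _≢_; refl; sym; trans; cong; subst; subst₂)
import Relation.Binary.PropositionalEquality.Properties as ≡
open import Relation.Binary.Structures using (IsEquivalence)
open import Relation.Nullary.Decidable.Core using (Dec; yes; no; recompute; from-yes; from-no; True; toWitness)
open import Relation.Nullary.Negation using (¬_; contradiction)
open import Relation.Unary using (Pred; Satisfiable)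

open Graph using (V)

-- Induction and adjacency on the integers

ℤ-induction : (P : Pred ℤ 0ℓ) → (∀ i → P i → P (sucℤ i)) → (∀ i → P (sucℤ i) → P i) →
              ∀ {i} → P i → ∀ j → P j
ℤ-induction P up down {i} Pi = fromZero (toZero i Pi)
  where
  toZero : ∀ i → P i → P (+ 0)
  toZero (+ zero)      p = p
  toZero (+ suc n)     p = toZero (+ n) (down (+ n) p)
  toZero -[1+ zero ]   p = up -[1+ 0 ] p
  toZero -[1+ suc n ]  p = toZero -[1+ n ] (up -[1+ suc n ] p)

  fromZero : P (+ 0) → ∀ j → P j
  fromZero p (+ zero)     = p
  fromZero p (+ suc n)    = up (+ n) (fromZero p (+ n))
  fromZero p -[1+ zero ]  = down -[1+ 0 ] p
  fromZero p -[1+ suc n ] = down -[1+ suc n ] (fromZero p -[1+ n ])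

infix 4 _⇄_
_⇄_ : Rel ℤ 0ℓ
i ⇄ j = j ≡ sucℤ i ⊎ i ≡ sucℤ j

⇄-sym : Symmetric _⇄_
⇄-sym (inj₁ p) = inj₂ p
⇄-sym (inj₂ p) = inj₁ p

⇄-irrefl : ∀ {i} → ¬ i ⇄ i
⇄-irrefl (inj₁ p) = ℤ.i≢suc[i] p
⇄-irrefl (inj₂ p) = ℤ.i≢suc[i] p

-- N is the edge relation of paths.  The equivalence ≈ (equality for the comb,
-- being joined by a rung for the ladder) is such that paths with equivalent
-- starting edges stay equivalent.
record IsLine {A : Set} (_≈_ N : Rel A 0ℓ) : Set where
  field
    isEquivalence : IsEquivalence _≈_
    N-sym         : Symmetric N
    continue      : ∀ {x y} → N x y →
                    ∃[ z ] (N y z × z ≢ x × (∀ {w} → N y w → w ≢ x → w ≡ z))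
    N⇒≉           : ∀ {x y} → N x y → ¬ x ≈ y
    fork          : ∀ {x y z} → N y x → N y z → x ≢ z → ¬ x ≈ z
    transport     : ∀ {x x′ y y′ z} → N x y → N x z → y ≢ z → x ≈ x′ → N x′ y′ →
                    y′ ≈ y ⊎ y′ ≈ z

  open IsEquivalence isEquivalence public
    using () renaming (refl to ≈-refl; sym to ≈-sym; trans to ≈-trans; reflexive to ≈-reflexive)

-- Walking along a line

module _ (em : ExcludedMiddle 0ℓ) {A : Set} {_≈_ N : Rel A 0ℓ} (line : IsLine _≈_ N) where
  open IsLine line

  other : A → A → A
  other y x with em {P = ∃[ z ] (N y z × z ≢ x)}
  ... | yes (z , _) = z
  -- A junk value: `continue` supplies a second neighbour whenever `N x y` holds.
  ... | no  _       = x

  other-spec : ∀ {x y} → N x y → N y (other y x) × other y x ≢ x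
  other-spec {x} {y} xy with em {P = ∃[ z ] (N y z × z ≢ x)}
  ... | yes (_ , p) = p
  ... | no  ¬p      = contradiction
    (let (z , yz , z≢x , _) = continue xy in z , yz , z≢x) ¬p

  other-unique : ∀ {x y w} → N x y → N y w → w ≢ x → w ≡ other y x
  other-unique xy yw w≢x =
    let (_ , _ , _ , unique) = continue xy
        (yo , o≢x)           = other-spec xy
    in trans (unique yw w≢x) (sym (unique yo o≢x))

  -- An oriented edge determines the walk through it in both directions, which a vertex alone does
  -- not.
  Dart : Set
  Dart = A × A

  Valid : Pred Dart 0ℓ
  Valid (x , y) = N x y

  _≋_ : Rel Dart 0ℓ
  (x , y) ≋ (x′ , y′) = x ≈ x′ × y ≈ y′

  ≋-sym : Symmetric _≋_
  ≋-sym (p , q) = ≈-sym p , ≈-sym q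

  ≋-trans : ∀ {d e f} → d ≋ e → e ≋ f → d ≋ f
  ≋-trans (p , q) (p′ , q′) = ≈-trans p p′ , ≈-trans q q′

  ≋-reflexive : ∀ {d e} → d ≡ e → d ≋ e
  ≋-reflexive refl = ≈-refl , ≈-refl

  next prev : Dart → Dart
  next (x , y) = y , other y x
  prev d       = swap (next (swap d))

  next-valid : ∀ d → Valid d → Valid (next d)
  next-valid _ v = proj₁ (other-spec v)

  prev-valid : ∀ d → Valid d → Valid (prev d)
  prev-valid d v = N-sym (next-valid (swap d) (N-sym v))

  -- Besides `other y x`, the only neighbour of `y` is `x`, so turning round and stepping undoes a
  -- step. As `prev` is `next` conjugated by `swap`, this one identity yields both inverse laws.
  next-swap-next : ∀ d → Valid d → next (swap (next d)) ≡ swap d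
  next-swap-next (x , y) v =
    let (yo , o≢x) = other-spec v
    in cong (y ,_) (sym (other-unique (N-sym yo) (N-sym v) (o≢x ∘ sym)))

  next-prev : ∀ d → Valid d → next (prev d) ≡ d
  next-prev d v = next-swap-next (swap d) (N-sym v)

  prev-next : ∀ d → Valid d → prev (next d) ≡ d
  prev-next d v = cong swap (next-swap-next d v)

  -- By `transport` the new endpoint is equivalent to the vertex behind or to the vertex ahead. The
  -- former would make two distinct neighbours of one vertex equivalent, against `fork`.
  next-cong : ∀ {d e} → Valid d → Valid e → d ≋ e → next d ≋ next e
  next-cong dv ev (x≈ , y≈)
    with (yo , o≢x) ← other-spec dv | (yo′ , o′≢x′) ← other-spec ev
    with transport (N-sym dv) yo (o≢x ∘ sym) y≈ yo′
  ... | inj₁ o′≈x = contradiction (≈-sym (≈-trans o′≈x x≈))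
                                  (fork (N-sym ev) yo′ (o′≢x′ ∘ sym))
  ... | inj₂ o′≈o = y≈ , ≈-sym o′≈o

  prev-cong : ∀ {d e} → Valid d → Valid e → d ≋ e → prev d ≋ prev e
  prev-cong dv ev d≋e = swap (next-cong (N-sym dv) (N-sym ev) (swap d≋e))

  advance : ℕ → Dart → Dart
  advance zero    d = d
  advance (suc n) d = next (advance n d)

  advance-next : ∀ n d → advance n (next d) ≡ next (advance n d)
  advance-next zero    d = refl
  advance-next (suc n) d = cong next (advance-next n d)

  advance-valid : ∀ n d → Valid d → Valid (advance n d)
  advance-valid zero    d v = v
  advance-valid (suc n) d v = next-valid _ (advance-valid n d v)

  -- Otherwise the two darts would move towards each other until they meet
  -- in a vertex or along an edge.
  never-turns : ∀ n d → Valid d → ¬ d ≋ swap (advance n d)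
  never-turns zero          d v (x≈y , _) = N⇒≉ v x≈y
  never-turns (suc zero)    d v (x≈o , _) =
    let (yo , o≢x) = other-spec v in fork (N-sym v) yo (o≢x ∘ sym) x≈o
  never-turns (suc (suc n)) d v d≋ = never-turns n (next d) (next-valid d v)
    (≋-trans
      (next-cong v (N-sym (advance-valid (suc (suc n)) d v)) d≋)
      (≋-reflexive (trans
        (next-swap-next _ (advance-valid (suc n) d v))
        (cong swap (sym (advance-next n d))))))

  -- By `transport` the second vertex of `d` continues either forwards or backwards along the walk.
  -- Backwards would mean that the walk has turned round, which `never-turns` excludes.
  return : ∀ n d → Valid d → proj₁ d ≈ proj₁ (advance (suc n) d) → d ≋ advance (suc n) d
  return n d v x≈
    with ev ← advance-valid n d v
    with (yo , o≢x) ← other-spec ev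
    with transport (N-sym ev) yo (o≢x ∘ sym) (≈-sym x≈) v
  ... | inj₁ y≈ = contradiction (x≈ , y≈) (never-turns n d v)
  ... | inj₂ y≈ = x≈ , y≈

  -- The two-way infinite walk through an edge, and its periods

  module _ {x₀ y₀} (x₀y₀ : N x₀ y₀) where

    dart : ℤ → Dart
    dart (+ zero)     = x₀ , y₀
    dart (+ suc n)    = next (dart (+ n))
    dart -[1+ zero ]  = prev (x₀ , y₀)
    dart -[1+ suc n ] = prev (dart -[1+ n ])

    dart-valid : ∀ i → Valid (dart i)
    dart-valid (+ zero)     = x₀y₀
    dart-valid (+ suc n)    = next-valid (dart (+ n)) (dart-valid (+ n))
    dart-valid -[1+ zero ]  = prev-valid (x₀ , y₀) x₀y₀
    dart-valid -[1+ suc n ] = prev-valid (dart -[1+ n ]) (dart-valid -[1+ n ])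

    dart-suc : ∀ i → dart (sucℤ i) ≡ next (dart i)
    dart-suc (+ n)        = refl
    dart-suc -[1+ zero ]  = sym (next-prev (x₀ , y₀) x₀y₀)
    dart-suc -[1+ suc n ] = sym (next-prev (dart -[1+ n ]) (dart-valid -[1+ n ]))

    dart-+ : ∀ n i → dart (+ n +ℤ i) ≡ advance n (dart i)
    dart-+ zero    i = cong dart (ℤ.+-identityˡ i)
    dart-+ (suc n) i = trans (cong dart (ℤ.+-assoc (+ 1) (+ n) i))
      (trans (dart-suc (+ n +ℤ i)) (cong next (dart-+ n i)))

    point : ℤ → A
    point i = proj₁ (dart i)

    dart-points : ∀ i → dart i ≡ (point i , point (sucℤ i))
    dart-points i = cong (point i ,_) (sym (cong proj₁ (dart-suc i)))

    point-N : ∀ i → N (point i) (point (sucℤ i))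
    point-N i = subst Valid (dart-points i) (dart-valid i)

    point-neighbours : ∀ i {w} → N (point (sucℤ i)) w →
                       w ≡ point i ⊎ w ≡ point (sucℤ (sucℤ i))
    point-neighbours i {w} pw with em {P = w ≡ point i}
    ... | yes w≡ = inj₁ w≡
    ... | no  w≢ = inj₂ (trans (other-unique (point-N i) pw w≢) (cong proj₂ next≡))
      where
      next≡ : next (point i , point (sucℤ i)) ≡ (point (sucℤ i) , point (sucℤ (sucℤ i)))
      next≡ = trans (sym (trans (dart-suc i) (cong next (dart-points i))))
                    (dart-points (sucℤ i))

    point-⇄ : ∀ {i j} → i ⇄ j → N (point i) (point j)
    point-⇄ {i}     (inj₁ refl) = point-N i
    point-⇄ {_} {j} (inj₂ refl) = N-sym (point-N j)

    point-lifts : ∀ i {w} → N (point i) w → ∃[ j ] (i ⇄ j × point j ≡ w)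
    point-lifts i pw
      -- `point-neighbours` speaks of a successor, so `i` is written as the successor of `pred i`.
      with point-neighbours (pred i) (subst (λ j → N (point j) _) (sym (ℤ.suc-pred i)) pw)
    ... | inj₁ refl = pred i , inj₂ (sym (ℤ.suc-pred i)) , refl
    ... | inj₂ refl = sucℤ i , inj₁ refl , cong (point ∘ sucℤ) (sym (ℤ.suc-pred i))

    FiniteImage : Set
    FiniteImage = ∃[ xs ] (∀ k → ∃[ x ] (x ∈ xs × point k ≈ x))

    -- By `return` not only the vertex but the whole dart recurs. Hence the darts at positions 0 to
    -- `n` after `i` form a cycle, up to equivalence, that neither `next` nor `prev` leaves.
    periodic : ∀ i n → point i ≈ point (+ suc n +ℤ i) → FiniteImage
    periodic i n fi≈ = map (λ m → proj₁ (advance m d)) (upTo (suc n)) , λ k →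
      let (m , m≤n , (p , _)) = ℤ-induction OnCycle up down {i} start k
      in _ , ∈-map⁺ _ (∈-upTo⁺ (s≤s m≤n)) , p
      where
      d : Dart
      d = dart i

      valid : ∀ m → Valid (advance m d)
      valid m = advance-valid m d (dart-valid i)

      loop : d ≋ advance (suc n) d
      loop = return n d (dart-valid i)
        (≈-trans fi≈ (≈-reflexive (cong proj₁ (dart-+ (suc n) i))))

      OnCycle : Pred ℤ 0ℓ
      OnCycle k = ∃[ m ] (m ≤ n × dart k ≋ advance m d)

      start : OnCycle i
      start = 0 , z≤n , ≋-reflexive refl

      up : ∀ k → OnCycle k → OnCycle (sucℤ k)
      up k (m , m≤n , e)
        with e′ ← ≋-trans (≋-reflexive (dart-suc k)) (next-cong (dart-valid k) (valid m) e)
        with ℕ.m≤n⇒m<n∨m≡n m≤n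
      ... | inj₁ m<n  = suc m , m<n , e′
      ... | inj₂ refl = 0 , z≤n , ≋-trans e′ (≋-sym loop)

      down : ∀ k → OnCycle (sucℤ k) → OnCycle k
      down k (m , m≤n , e) = back m m≤n
        (≋-trans (≋-reflexive (trans (sym (prev-next (dart k) (dart-valid k))) (cong prev (sym (dart-suc k)))))
                 (prev-cong (dart-valid (sucℤ k)) (valid m) e))
        where
        back : ∀ m → m ≤ n → dart k ≋ prev (advance m d) → OnCycle k
        -- Stepping back from position 0 wraps round to position `n`, through `loop`.
        back zero    _     e = n , ℕ.≤-refl ,
          ≋-trans e (≋-trans (prev-cong (valid 0) (valid (suc n)) loop)
                             (≋-reflexive (prev-next (advance n d) (valid n))))
        back (suc m) 1+m≤n e = m , ℕ.<⇒≤ 1+m≤n , ≋-trans e (≋-reflexive (prev-next (advance m d) (valid m)))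

    injective-or-finite : (∀ {i j} → point i ≈ point j → i ≡ j) ⊎ FiniteImage
    injective-or-finite with em {P = FiniteImage}
    ... | yes fin  = inj₂ fin
    ... | no  ¬fin = inj₁ λ {i} {j} → injective i j
      where
      i≡[i-j]+j : ∀ i j → i ≡ (i - j) +ℤ j
      i≡[i-j]+j i j = sym (trans (ℤ.+-assoc i _ j)
        (trans (cong (i +ℤ_) (ℤ.+-inverseˡ j)) (ℤ.+-identityʳ i)))

      -[i-j]≡j-i : ∀ i j → -ℤ (i - j) ≡ j - i
      -[i-j]≡j-i i j = trans (ℤ.neg-distrib-+ i (-ℤ j))
        (trans (cong (-ℤ i +ℤ_) (ℤ.neg-involutive j)) (ℤ.+-comm (-ℤ i) j))

      injective : ∀ i j → point i ≈ point j → i ≡ j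
      -- The sign of the difference tells which index comes first; the period starts there.
      injective i j fi≈fj with i - j in eq
      ... | + zero   = trans (i≡[i-j]+j i j) (trans (cong (_+ℤ j) eq) (ℤ.+-identityˡ j))
      ... | + suc n  = contradiction
        (periodic j n (≈-trans (≈-sym fi≈fj)
          (≈-reflexive (cong point (trans (i≡[i-j]+j i j) (cong (_+ℤ j) eq)))))) ¬fin
      ... | -[1+ n ] = contradiction
        (periodic i n (≈-trans fi≈fj
          (≈-reflexive (cong point (trans (i≡[i-j]+j j i)
            (cong (_+ℤ i) (trans (sym (-[i-j]≡j-i i j)) (cong -ℤ_ eq)))))))) ¬fin

-- Finite and infinite types

lookup-injective : ∀ {A : Set} {xs : List A} → Unique xs →
                   ∀ i j → lookup xs i ≡ lookup xs j → i ≡ j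
lookup-injective (_ ∷ _)  Fin.zero    Fin.zero    _  = refl
lookup-injective (x∉ ∷ _) Fin.zero    (Fin.suc j) eq = contradiction eq (All.lookup x∉ (∈-lookup j))
lookup-injective (x∉ ∷ _) (Fin.suc i) Fin.zero    eq = contradiction (sym eq) (All.lookup x∉ (∈-lookup i))
lookup-injective (_ ∷ u)  (Fin.suc i) (Fin.suc j) eq = cong Fin.suc (lookup-injective u i j eq)

-- Excluded middle decides equality, so repetitions can be removed. The bound by the length turns a
-- list of neighbours into a degree bound.
covered⇒finite : ExcludedMiddle 0ℓ → ∀ {A : Set} (xs : List A) → (∀ a → a ∈ xs) →
                 ∃[ d ] (d ≤ length xs × (A ↔ Fin d))
covered⇒finite em {A} xs covers = length ys , length-deduplicate _≟_ xs , mk↔ₛ′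
  (index ∘ ∈ys)
  (lookup ys)
  (λ i → lookup-injective (deduplicate-! _≟_ xs) _ i (sym (lookup-index (∈ys (lookup ys i)))))
  (sym ∘ lookup-index ∘ ∈ys)
  where
  _≟_ : (x y : A) → Dec (x ≡ y)
  x ≟ y = em

  ys : List A
  ys = deduplicate _≟_ xs

  ∈ys : ∀ a → a ∈ ys
  ∈ys a = ∈-deduplicate⁺ _≟_ (covers a)

injection⇒infinite : ∀ {A : Set} (f : ℕ → A) → (∀ {m n} → f m ≡ f n → m ≡ n) → Infinite A
injection⇒infinite f injective (n , A↔Fin) =
  ℕ.1+n≰n (injective⇒≤ {f = to ∘ f ∘ toℕ} (λ eq → toℕ-injective (injective (to-injective eq))))
  where
  open Inverse A↔Fin
  to-injective : ∀ {x y} → to x ≡ to y → x ≡ y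
  to-injective eq = trans (sym (strictlyInverseʳ _)) (trans (cong from eq) (strictlyInverseʳ _))

-- Walks and coverings of graphs

module _ {G : Graph} where

  _++ʷ_ : ∀ {m n x y z} → Walk G m x y → Walk G n y z → ∃[ k ] Walk G k x z
  []      ++ʷ w′ = _ , w′
  (e ∷ w) ++ʷ w′ = _ , e ∷ proj₂ (w ++ʷ w′)

  Reachable-trans : ∀ {x y z} → Reachable G x y → Reachable G y z → Reachable G x z
  Reachable-trans (_ , w) (_ , w′) = w ++ʷ w′

  edge⇒reachable : ∀ {x y} → G [ x ~ y ] → Reachable G x y
  edge⇒reachable e = 1 , e ∷ []

  _∷ʳʷ_ : ∀ {n x y z} → Walk G n x y → G [ y ~ z ] → Walk G (suc n) x z
  []      ∷ʳʷ e′ = e′ ∷ []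
  (e ∷ w) ∷ʳʷ e′ = e ∷ (w ∷ʳʷ e′)

  unsnoc : ∀ {n x z} → Walk G (suc n) x z → ∃[ y ] (Walk G n x y × G [ y ~ z ])
  unsnoc (e ∷ [])         = _ , [] , e
  unsnoc (e ∷ w@(_ ∷ _)) = let (y , w′ , e′) = unsnoc w in y , e ∷ w′ , e′

  reverse : ∀ {n x y} → Walk G n x y → Walk G n y x
  reverse []      = []
  reverse (e ∷ w) = reverse w ∷ʳʷ Graph.~-sym G e

  Reachable-sym : ∀ {x y} → Reachable G x y → Reachable G y x
  Reachable-sym (n , w) = n , reverse w

record Covering (G H : Graph) : Set where
  field
    cover     : V G → V H
    preserves : ∀ {x y} → G [ x ~ y ] → H [ cover x ~ cover y ]
    lifts     : ∀ {x w} → H [ cover x ~ w ] → ∃[ y ] (G [ x ~ y ] × cover y ≡ w)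

  surjective : Connected H → V G → ∀ w → ∃[ x ] cover x ≡ w
  surjective connected x₀ w = lift-walk (proj₂ (connected (cover x₀) w))
    where
    lift-walk : ∀ {n x} → Walk H n (cover x) w → ∃[ y ] cover y ≡ w
    lift-walk []      = _ , refl
    lift-walk (e ∷ p) with (y , _ , refl) ← lifts e = lift-walk p

  -- Edges are reflected because an edge between images lifts to an edge whose end has the expected
  -- image, and injectivity identifies that end.
  injective⇒≅ : Connected H → V G → (∀ {x y} → cover x ≡ cover y → x ≡ y) → G ≅ H
  injective⇒≅ connected x₀ injective = record
    { bij       = mk↔ₛ′ cover (proj₁ ∘ inverse) (proj₂ ∘ inverse)
                        (λ x → injective (proj₂ (inverse (cover x))))
    ; preserves = preserves
    ; reflects  = λ {x} e → let (_ , x~y′ , eq) = lifts e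
                            in subst (G [ x ~_]) (injective eq) x~y′
    }
    where inverse = surjective connected x₀

-- Balls, and the topology at an isolated graph

≅ᵣ-trans : ∀ {A B C} → A ≅ᵣ B → B ≅ᵣ C → A ≅ᵣ C
≅ᵣ-trans (φ , φ-root) (ψ , ψ-root) = ≅-trans φ ψ , trans (cong (_≅_.to ψ) φ-root) ψ-root

Ball-cong : ∀ {G H} (φ : G ≅ H) r v → Ball r G v ≅ᵣ Ball r H (_≅_.to φ v)
Ball-cong {G} {H} φ r v = record
  { bij = mk↔ₛ′
      (λ (x ∣ᵣ [ p ]) → to x ∣ᵣ [ push p ])
      (λ (y ∣ᵣ [ q ]) → from y ∣ᵣ [ pull q ])
      (λ y → value-injective (strictlyInverseˡ (value y)))
      (λ x → value-injective (strictlyInverseʳ (value x)))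
  ; preserves = preserves
  ; reflects  = reflects
  } , refl
  where
  open _≅_ φ
  push : ∀ {x} → DistanceAtMost G r v x → DistanceAtMost H r (to v) (to x)
  push (n , n≤r , w) = n , n≤r , mapWalk φ w
  pull : ∀ {y} → DistanceAtMost H r (to v) y → DistanceAtMost G r v (from y)
  pull {y} (n , n≤r , w) = n , n≤r ,
    subst (λ u → Walk G n u (from y)) (strictlyInverseʳ v) (mapWalk (≅-sym φ) w)

module Isolated (em : ExcludedMiddle 0ℓ) {D} (G : InfiniteGraph D)
  (rigid : ∀ {r} → 3 ≤ r → (H : InfiniteGraph D) →
           (∀ v → ∃[ z ] (Ball r ⌊ H ⌋ v ≅ᵣ Ball r ⌊ G ⌋ z)) → ⌊ G ⌋ ≅ ⌊ H ⌋) where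

  class : Subset (𝔊∞≤ D)
  class = record { mem = λ H → ⌊ G ⌋ ≅ ⌊ H ⌋ ; resp = λ H≅K G≅H → ≅-trans G≅H H≅K }

  -- This fixes the radius `2^- 2` in `class-open`: being strictly closer means agreement on balls
  -- of some radius at least 3.
  2^-r<¼⇒3≤r : ∀ r → (2^- r) <ℚ (2^- 2) → 3 ≤ r
  2^-r<¼⇒3≤r 0 lt = contradiction lt (from-no ((2^- 0) ℚ.<? (2^- 2)))
  2^-r<¼⇒3≤r 1 lt = contradiction lt (from-no ((2^- 1) ℚ.<? (2^- 2)))
  2^-r<¼⇒3≤r 2 lt = contradiction lt (from-no ((2^- 2) ℚ.<? (2^- 2)))
  2^-r<¼⇒3≤r (suc (suc (suc r))) _ = s≤s (s≤s (s≤s z≤n))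

  class-open : Open class
  class-open H G≅H = (2^- 2) , from-yes (0ℚ ℚ.<? (2^- 2)) , λ where
    K (r , lt , _ , 𝔅K⊆𝔅H) → rigid (2^-r<¼⇒3≤r r lt) K λ v →
      let (u , ball) = 𝔅K⊆𝔅H (v , ≅-refl , refl)
      in _ , ≅ᵣ-trans ball (Ball-cong (≅-sym G≅H) r u)

  -- Some `N n` contains `G`. A non-empty open `U` inside the class of `G` contains a copy of `G`,
  -- hence `G` itself since subsets respect isomorphism; so `U` cannot avoid `N n`.
  not-meager : (S : Subset (𝔊∞≤ D)) → Subset.mem S G → ¬ Meager S
  not-meager S G∈S (N , nowhereDense , S⊆⋃N , _) =
    let (n , G∈Nₙ)                           = S⊆⋃N G∈S
        (U , _ , (H , H∈U) , U⊆class , empty) = nowhereDense n class class-open (G , ≅-refl)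
    in empty G (Subset.resp U {H} {G} (≅-sym (U⊆class H∈U)) H∈U , G∈Nₙ)

inhabited : ExcludedMiddle 0ℓ → ∀ {A : Set} → Infinite A → A
inhabited em {A} infinite with em {P = A}
... | yes a = a
... | no ¬a = contradiction
  (let (d , _ , A↔Fin) = covered⇒finite em [] (⊥-elim ∘ ¬a) in d , A↔Fin) infinite

-- Charts

-- An isomorphism of balls as a map on all vertices, with junk values outside the
-- ball around z.
record Chart (r : ℕ) (G : Graph) (z : V G) (H : Graph) : Set where
  field
    chart     : V G → V H
    preserves : ∀ {x y} → DistanceAtMost G r z x → DistanceAtMost G r z y →
                G [ x ~ y ] → H [ chart x ~ chart y ]
    reflects  : ∀ {x y} → DistanceAtMost G r z x → DistanceAtMost G r z y →
                H [ chart x ~ chart y ] → G [ x ~ y ]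
    injective : ∀ {x y} → DistanceAtMost G r z x → DistanceAtMost G r z y →
                chart x ≡ chart y → x ≡ y
    onto      : ∀ {w} → DistanceAtMost H r (chart z) w →
                ∃[ x ] (DistanceAtMost G r z x × chart x ≡ w)

ball-chart : ExcludedMiddle 0ℓ → ∀ {r G z H v} → Ball r H v ≅ᵣ Ball r G z →
             Σ (Chart r G z H) λ C → Chart.chart C z ≡ v
ball-chart em {r} {G} {z} {H} {v} (φ , φ-root) = record
  { chart     = chart
  ; preserves = λ p q e → subst₂ (H [_~_]) (sym (chart-within p)) (sym (chart-within q))
                                 (_≅_.preserves (≅-sym φ) e)
  ; reflects  = λ p q e → _≅_.reflects (≅-sym φ)
                            (subst₂ (H [_~_]) (chart-within p) (chart-within q) e)
  ; injective = λ p q eq → cong value (from-injective (value-injective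
                  (trans (sym (chart-within p)) (trans eq (chart-within q)))))
  ; onto      = λ {w} p → onto (w ∣ᵣ [ subst (λ u → DistanceAtMost H r u w) centre p ])
  } , centre
  where
  open _≅_ φ using (to; from; strictlyInverseˡ; strictlyInverseʳ)

  chart : V G → V H
  chart x with em {P = DistanceAtMost G r z x}
  ... | yes p = value (from (x ∣ᵣ [ p ]))
  ... | no  _ = v

  chart-within : ∀ {x} (p : DistanceAtMost G r z x) → chart x ≡ value (from (x ∣ᵣ [ p ]))
  chart-within {x} p with em {P = DistanceAtMost G r z x}
  ... | yes _ = refl
  ... | no ¬p = contradiction p ¬p

  centre : chart z ≡ v
  centre = trans (chart-within (zero , z≤n , []))
                 (cong value (trans (cong from (sym φ-root)) (strictlyInverseʳ _)))

  from-injective : ∀ {x y} → from x ≡ from y → x ≡ y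
  from-injective eq = trans (sym (strictlyInverseˡ _)) (trans (cong to eq) (strictlyInverseˡ _))

  onto : ∀ w → ∃[ x ] (DistanceAtMost G r z x × chart x ≡ value w)
  onto w with to w in eq
  -- The membership proof `p` is irrelevant; excluded middle restores a usable one.
  ... | x ∣ᵣ [ p ] = x , recompute em p , trans (chart-within (recompute em p))
    (cong value (trans (cong from (sym eq)) (strictlyInverseʳ w)))

module LocalChart {r G z H} (3≤r : 3 ≤ r) (C : Chart r G z H) where
  open Chart C public using (chart)

  Near : ℕ → Pred (V G) 0ℓ
  Near k = DistanceAtMost G k z

  near-centre : ∀ {k} → Near k z
  near-centre = zero , z≤n , []

  -- The bound is a decision, so at concrete numerals it is settled by evaluation. The same device
  -- is used in `lift`.
  weaken : ∀ {k x} l {k≤l : True (k ≤? l)} → Near k x → Near l x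
  weaken l {k≤l} (n , n≤k , w) = n , ℕ.≤-trans n≤k (toWitness k≤l) , w

  step : ∀ {k x y} → Near k x → G [ x ~ y ] → Near (suc k) y
  step (n , n≤k , w) e = suc n , s≤s n≤k , w ∷ʳʷ e

  within : ∀ {x} → Near 3 x → Near r x
  within (n , n≤3 , w) = n , ℕ.≤-trans n≤3 3≤r , w

  preserves : ∀ {x y} → Near 3 x → Near 3 y → G [ x ~ y ] → H [ chart x ~ chart y ]
  preserves p q = Chart.preserves C (within p) (within q)

  reflects : ∀ {x y} → Near 3 x → Near 3 y → H [ chart x ~ chart y ] → G [ x ~ y ]
  reflects p q = Chart.reflects C (within p) (within q)

  injective : ∀ {x y} → Near 3 x → Near 3 y → chart x ≡ chart y → x ≡ y
  injective p q = Chart.injective C (within p) (within q)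

  -- `Chart.onto` measures distance in `H` from the image of the centre. Pushing walks forward
  -- bounds that distance, every prefix staying inside the ball.
  chart-walk : ∀ n {x} → n ≤ r → Walk G n z x → Walk H n (chart z) (chart x)
  chart-walk zero    _     []  = []
  chart-walk (suc n) 1+n≤r w   =
    let (y , w′ , e) = unsnoc w
        n≤r          = ℕ.<⇒≤ 1+n≤r
    in chart-walk n n≤r w′ ∷ʳʷ Chart.preserves C (n , n≤r , w′) (suc n , 1+n≤r , w) e

  -- From distance at most 2 an edge of `H` ends at distance at most 3 from the centre, hence still
  -- in the image of the chart.
  lift : ∀ {k x w} {k<3 : True (k <? 3)} → Near k x → H [ chart x ~ w ] →
         ∃[ y ] (G [ x ~ y ] × Near (suc k) y × chart y ≡ w)
  lift {k} {x} {k<3 = k<3} near@(n , n≤k , walk) e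
    with n<3 ← ℕ.≤-<-trans n≤k (toWitness k<3)
    with n<r ← ℕ.<-≤-trans n<3 3≤r
    with (y , near-y , refl) ← Chart.onto C (suc n , n<r , (chart-walk n (ℕ.<⇒≤ n<r) walk ∷ʳʷ e))
    with x~y ← Chart.reflects C (n , ℕ.<⇒≤ n<r , walk) near-y e
    = y , x~y , step near x~y , refl

-- Neighbours of an integer

sucℤ-injective : ∀ {i j} → sucℤ i ≡ sucℤ j → i ≡ j
sucℤ-injective eq = trans (sym (ℤ.pred-suc _)) (trans (cong pred eq) (ℤ.pred-suc _))

i<suc[i] : ∀ i → i <ℤ sucℤ i
i<suc[i] i = ℤ.suc[i]≤j⇒i<j ℤ.≤-refl

i<suc² : ∀ i → i <ℤ sucℤ (sucℤ i)
i<suc² i = ℤ.<-trans (i<suc[i] i) (i<suc[i] _)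

i<suc⁴ : ∀ i → i <ℤ sucℤ (sucℤ (sucℤ (sucℤ i)))
i<suc⁴ i = ℤ.<-trans (i<suc² i) (i<suc² _)

opposite : ∀ {i j} → i ⇄ j → ∃[ k ] (i ⇄ k × k ≢ j × (∀ {l} → i ⇄ l → l ≢ j → l ≡ k))
opposite {i} (inj₁ refl) = pred i , inj₂ (sym (ℤ.suc-pred i)) ,
  (λ eq → ℤ.<-irrefl (trans (sym (ℤ.suc-pred i)) (cong sucℤ eq)) (i<suc² i)) , λ where
    (inj₁ p)    l≢ → contradiction p l≢
    (inj₂ refl) _  → sym (ℤ.pred-suc _)
opposite {_} {j} (inj₂ refl) = sucℤ (sucℤ j) , inj₁ refl ,
  (λ eq → ℤ.<-irrefl (sym eq) (i<suc² j)) , λ where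
    (inj₁ p) _  → p
    (inj₂ p) l≢ → contradiction (sucℤ-injective (sym p)) l≢

-- The path has no 4-cycle: `j` and `k` lie on the two sides of `i`, two apart, so `i` is their only
-- common neighbour. The inequality `i<suc⁴` rules out that `m` lies beyond both.
no-square : ∀ {i j k m} → i ⇄ j → i ⇄ k → k ≢ j → j ⇄ m → k ⇄ m → m ≡ i
no-square (inj₁ p)    (inj₁ q)    k≢j _  _  = contradiction (trans q (sym p)) k≢j
no-square (inj₂ p)    (inj₂ q)    k≢j _  _  = contradiction (sucℤ-injective (trans (sym q) p)) k≢j
no-square (inj₁ refl) (inj₂ refl) _   jm km = above jm km
  where
  above : ∀ {k m} → sucℤ (sucℤ k) ⇄ m → k ⇄ m → m ≡ sucℤ k
  above (inj₂ p)    _        = sucℤ-injective (sym p)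
  above (inj₁ _)    (inj₁ q) = q
  above (inj₁ refl) (inj₂ q) = contradiction (i<suc⁴ _) (ℤ.<-irrefl q)
no-square (inj₂ refl) (inj₁ refl) _   jm km = below jm km
  where
  below : ∀ {j m} → j ⇄ m → sucℤ (sucℤ j) ⇄ m → m ≡ sucℤ j
  below (inj₁ p)    _           = p
  below (inj₂ p)    (inj₂ q)    = sucℤ-injective (sym q)
  below (inj₂ p)    (inj₁ refl) = contradiction (i<suc⁴ _) (ℤ.<-irrefl p)

-- The comb, the ladder and their local recognition

data CombVertex : Set where
  spine tooth : ℤ → CombVertex

data CombEdge : Rel CombVertex 0ℓ where
  along : ∀ {i j} → i ⇄ j → CombEdge (spine i) (spine j)
  up    : ∀ {i} → CombEdge (spine i) (tooth i)
  down  : ∀ {i} → CombEdge (tooth i) (spine i)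

Comb : Graph
Comb = record
  { V     = CombVertex
  ; _~_   = CombEdge
  ; ~-sym = λ where
      (along p) → along (⇄-sym p)
      up        → down
      down      → up
  ; ~-irr = λ where refl (along p) → ⇄-irrefl p
  }

data LadderEdge : Rel (ℤ × Bool) 0ℓ where
  rail : ∀ {i j b} → i ⇄ j → LadderEdge (i , b) (j , b)
  rung : ∀ {i b b′} → b ≢ b′ → LadderEdge (i , b) (i , b′)

Ladder : Graph
Ladder = record
  { V     = ℤ × Bool
  ; _~_   = LadderEdge
  ; ~-sym = λ where
      (rail p) → rail (⇄-sym p)
      (rung p) → rung (p ∘ sym)
  ; ~-irr = λ where
      refl (rail p) → ⇄-irrefl p
      refl (rung p) → p refl
  }

≢-unique : ∀ {b b′ b″ : Bool} → b ≢ b′ → b ≢ b″ → b′ ≡ b″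
≢-unique p q = trans (¬-not (p ∘ sym)) (sym (¬-not (q ∘ sym)))

-- Degree at least two, which in the comb singles out the spine from the teeth.
Branching : (G : Graph) → Pred (V G) 0ℓ
Branching G x = ∃[ a ] ∃[ b ] (a ≢ b × G [ x ~ a ] × G [ x ~ b ])

-- In the ladder, a rung spans a 4-cycle with every other edge at either end.
Rung Rail : (G : Graph) → Rel (V G) 0ℓ
Rung G x y = G [ x ~ y ] ×
  (∀ {a} → G [ x ~ a ] → a ≢ y → ∃[ b ] (G [ y ~ b ] × G [ a ~ b ] × b ≢ x))
Rail G x y = G [ x ~ y ] × ¬ Rung G x y

module LocalPredicates {r G z H} (3≤r : 3 ≤ r) (C : Chart r G z H) where
  open LocalChart 3≤r C public

  branching⁺ : ∀ {x} → Near 2 x → Branching G x → Branching H (chart x)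
  branching⁺ nx (a , b , a≢b , xa , xb) =
    chart a , chart b ,
    a≢b ∘ injective (step nx xa) (step nx xb) ,
    preserves (weaken 3 nx) (step nx xa) xa , preserves (weaken 3 nx) (step nx xb) xb

  branching⁻ : ∀ {x} → Near 2 x → Branching H (chart x) → Branching G x
  branching⁻ nx (a , b , a≢b , xa , xb)
    with (a′ , xa′ , _ , refl) ← lift nx xa | (b′ , xb′ , _ , refl) ← lift nx xb
    = a′ , b′ , a≢b ∘ cong chart , xa′ , xb′

  -- The 4-cycles in question stay within distance 2 of `x`, so `Near 1 x` keeps them where the
  -- chart is faithful. For `Branching`, which looks one step away, `Near 2 x` is enough.
  rung⁺ : ∀ {x y} → Near 1 x → Rung G x y → Rung H (chart x) (chart y)
  rung⁺ {x} {y} nx (xy , square) = preserves (weaken 3 nx) (weaken 3 ny) xy , square′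
    where
    ny : Near 2 y
    ny = step nx xy
    square′ : ∀ {a} → H [ chart x ~ a ] → a ≢ chart y →
              ∃[ b ] (H [ chart y ~ b ] × H [ a ~ b ] × b ≢ chart x)
    square′ xa a≢y
      with (a , xa′ , na , refl) ← lift nx xa
      with (b , yb , ab , b≢x) ← square xa′ (a≢y ∘ cong chart)
      = chart b , preserves (weaken 3 ny) nb yb , preserves (weaken 3 na) nb ab ,
        b≢x ∘ injective nb (weaken 3 nx)
      where
      nb : Near 3 b
      nb = step ny yb

  rung⁻ : ∀ {x y} → Near 1 x → G [ x ~ y ] → Rung H (chart x) (chart y) → Rung G x y
  rung⁻ {x} {y} nx xy (_ , square) = xy , square′
    where
    ny : Near 2 y
    ny = step nx xy
    square′ : ∀ {a} → G [ x ~ a ] → a ≢ y → ∃[ b ] (G [ y ~ b ] × G [ a ~ b ] × b ≢ x)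
    square′ {a} xa a≢y
      with na ← step nx xa
      with (b , yb , ab , b≢x) ← square (preserves (weaken 3 nx) (weaken 3 na) xa)
                                        (a≢y ∘ injective (weaken 3 na) (weaken 3 ny))
      with (b , yb′ , nb , refl) ← lift ny yb
      = b , yb′ , reflects (weaken 3 na) nb ab , b≢x ∘ cong chart

  rail⁺ : ∀ {x y} → Near 1 x → Rail G x y → Rail H (chart x) (chart y)
  rail⁺ nx (xy , ¬rung) =
    preserves (weaken 3 nx) (weaken 3 (step nx xy)) xy , ¬rung ∘ rung⁻ nx xy

  rail⁻ : ∀ {x y} → Near 1 x → G [ x ~ y ] → Rail H (chart x) (chart y) → Rail G x y
  rail⁻ nx xy (_ , ¬rung) = xy , ¬rung ∘ rung⁺ nx

ladder-rung : ∀ {i b b′} → b ≢ b′ → Rung Ladder (i , b) (i , b′)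
ladder-rung {i} {b} {b′} b≢b′ = rung b≢b′ , λ where
  (rail i⇄j)  _  → _ , rail i⇄j , rung b≢b′ , λ eq → b≢b′ (sym (cong proj₂ eq))
  (rung b≢b″) a≢ → contradiction (cong (i ,_) (≢-unique b≢b″ b≢b′)) a≢

-- The other rail edge at `i` leads to `k` and spans no 4-cycle with this one. A fourth vertex on
-- the same rail is excluded by `no-square`, and one on the opposite rail would force `k` and `j` to
-- coincide.
ladder-rail : ∀ {i j b} → i ⇄ j → Rail Ladder (i , b) (j , b)
ladder-rail {i} {j} {b} i⇄j = rail i⇄j , λ (_ , square) →
  let (k , i⇄k , k≢j , _) = opposite i⇄j
  in no-4-cycle i⇄k k≢j (square (rail i⇄k) (k≢j ∘ cong proj₁))
  where
  no-4-cycle : ∀ {k} → i ⇄ k → k ≢ j →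
    ¬ (∃[ a ] (LadderEdge (j , b) a × LadderEdge (k , b) a × a ≢ (i , b)))
  no-4-cycle i⇄k k≢j (_ , rail j⇄m , rail k⇄m , m≢i) =
    m≢i (cong (_, b) (no-square i⇄j i⇄k k≢j j⇄m k⇄m))
  no-4-cycle i⇄k k≢j (_ , rail _ , rung b≢b , _) = b≢b refl
  no-4-cycle i⇄k k≢j (_ , rung b≢b , rail _ , _) = b≢b refl
  no-4-cycle i⇄k k≢j (_ , rung _ , rung _ , _)   = k≢j refl

rung-inversion : ∀ {i b y} → Rung Ladder (i , b) y → ∃[ b′ ] (b ≢ b′ × (i , b′) ≡ y)
rung-inversion (rung b≢b′ , _) = _ , b≢b′ , refl
rung-inversion r@(rail i⇄j , _) = contradiction r (proj₂ (ladder-rail i⇄j))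

rail-inversion : ∀ {i b y} → Rail Ladder (i , b) y → ∃[ j ] (i ⇄ j × (j , b) ≡ y)
rail-inversion (rail i⇄j , _)      = _ , i⇄j , refl
rail-inversion (rung b≢b′ , ¬rung) = contradiction (ladder-rung b≢b′) ¬rung

module _ (em : ExcludedMiddle 0ℓ) where

  select : {A : Set} (P : Pred A 0ℓ) → A → A
  select P default with em {P = Satisfiable P}
  ... | yes (x , _) = x
  ... | no  _       = default

  select-spec : {A : Set} (P : Pred A 0ℓ) (default : A) → Satisfiable P → P (select P default)
  select-spec P default p with em {P = Satisfiable P}
  ... | yes (_ , q) = q
  ... | no ¬p       = contradiction p ¬p

  -- For equality, `transport` only says that a vertex has no third neighbour, which is the
  -- uniqueness in `continue`.
  ≡-line : {A : Set} {N : Rel A 0ℓ} → Symmetric N → (∀ {x} → ¬ N x x) →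
           (∀ {x y} → N x y → ∃[ z ] (N y z × z ≢ x × (∀ {w} → N y w → w ≢ x → w ≡ z))) →
           IsLine _≡_ N
  ≡-line {N = N} N-sym N-irrefl continue = record
    { isEquivalence = ≡.isEquivalence
    ; N-sym         = N-sym
    ; continue      = continue
    ; N⇒≉           = λ where xy refl → N-irrefl xy
    ; fork          = λ _ _ x≢z → x≢z
    ; transport     = transport
    }
    where
    transport : ∀ {x x′ y y′ z} → N x y → N x z → y ≢ z → x ≡ x′ → N x′ y′ → y′ ≡ y ⊎ y′ ≡ z
    transport {y = y} {y′} xy xz y≢z refl xy′ with em {P = y′ ≡ y}
    ... | yes y′≡y = inj₁ y′≡y
    ... | no  y′≢y = let (_ , _ , _ , unique) = continue (N-sym xy)
                     in inj₂ (trans (unique xy′ y′≢y) (sym (unique xz (y≢z ∘ sym))))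

  -- Rigidity of the comb

  module CombRigid {r} (3≤r : 3 ≤ r) (H : Graph)
    (connected : Connected H) (infinite : Infinite (V H))
    (charted : ∀ v → ∃[ z ] (Σ (Chart r Comb z H) λ C → Chart.chart C z ≡ v)) where

    spine-branching : ∀ i → Branching Comb (spine i)
    spine-branching i = tooth i , spine (sucℤ i) , (λ ()) , up , along (inj₁ refl)

    tooth-unbranching : ∀ i → ¬ Branching Comb (tooth i)
    tooth-unbranching i (_ , _ , a≢b , down , down) = a≢b refl

    N : Rel (V H) 0ℓ
    N x y = H [ x ~ y ] × Branching H x × Branching H y

    N-sym : Symmetric N
    N-sym (xy , bx , by) = Graph.~-sym H xy , by , bx

    -- In a chart at `y` the centre is a spine vertex because `y` branches. Its tooth does not
    -- branch, so the two neighbours along the spine are the only candidates.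
    continue : ∀ {x y} → N x y →
               ∃[ z ] (N y z × z ≢ x × (∀ {w} → N y w → w ≢ x → w ≡ z))
    continue {x} {y} (xy , bx , by) with charted y
    ... | tooth i , C , refl =
      contradiction (branching⁻ near-centre by) (tooth-unbranching i)
      where open LocalPredicates 3≤r C
    ... | spine i , C , refl = next-spine (lift (near-centre {0}) (Graph.~-sym H xy))
      where
      open LocalPredicates 3≤r C
      next-spine : ∃[ x′ ] (CombEdge (spine i) x′ × Near 1 x′ × chart x′ ≡ x) →
                   ∃[ z ] (N (chart (spine i)) z × z ≢ x ×
                           (∀ {w} → N (chart (spine i)) w → w ≢ x → w ≡ z))
      next-spine (_ , up , nt , refl) =
        contradiction (branching⁻ (weaken 2 nt) bx) (tooth-unbranching i)
      next-spine (_ , along i⇄j , nj , refl) =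
        let (k , i⇄k , k≢j , unique) = opposite i⇄j
            nk                       = step (near-centre {0}) (along i⇄k)
        in chart (spine k) ,
           (preserves near-centre (weaken 3 nk) (along i⇄k) , by ,
            branching⁺ (weaken 2 nk) (spine-branching k)) ,
           (λ eq → k≢j (spine-injective (injective (weaken 3 nk) (weaken 3 nj) eq))) ,
           λ (yw , _ , bw) w≢x → unique-spine unique (lift (near-centre {0}) yw) bw w≢x
        where
        spine-injective : ∀ {i j} → spine i ≡ spine j → i ≡ j
        spine-injective refl = refl
        unique-spine : ∀ {j k w} → (∀ {l} → i ⇄ l → l ≢ j → l ≡ k) →
          ∃[ w′ ] (CombEdge (spine i) w′ × Near 1 w′ × chart w′ ≡ w) →
          Branching H w → w ≢ chart (spine j) → w ≡ chart (spine k)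
        unique-spine unique (_ , up , nt , refl) bw _ =
          contradiction (branching⁻ (weaken 2 nt) bw) (tooth-unbranching i)
        unique-spine unique (_ , along i⇄l , _ , refl) _ w≢x =
          cong (chart ∘ spine) (unique i⇄l λ where refl → w≢x refl)

    line : IsLine _≡_ N
    line = ≡-line N-sym (λ (xx , _) → Graph.~-irr H refl xx) continue

    Tooth : Rel (V H) 0ℓ
    Tooth x t = H [ x ~ t ] × ¬ Branching H t

    toothOf : V H → V H
    toothOf x = select (Tooth x) x

    tooth-unique : ∀ {x} → Branching H x →
                   Satisfiable (Tooth x) × (∀ {t t′} → Tooth x t → Tooth x t′ → t ≡ t′)
    tooth-unique {x} bx with charted x
    ... | tooth i , C , refl =
      contradiction (branching⁻ near-centre bx) (tooth-unbranching i)
      where open LocalPredicates 3≤r C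
    ... | spine i , C , refl =
      (chart (tooth i) , preserves near-centre (weaken 3 nt) up ,
        tooth-unbranching i ∘ branching⁻ (weaken 2 nt)) ,
      λ p q → trans (is-tooth p) (sym (is-tooth q))
      where
      open LocalPredicates 3≤r C
      nt : Near 1 (tooth i)
      nt = step near-centre up
      is-tooth : ∀ {t} → Tooth (chart (spine i)) t → t ≡ chart (tooth i)
      is-tooth (xt , ¬bt) with lift (near-centre {0}) xt
      ... | _ , up        , _  , refl = refl
      ... | _ , along i⇄j , nj , refl =
        contradiction (branching⁺ (weaken 2 nj) (spine-branching _)) ¬bt

    toothOf-spec : ∀ {x} → Branching H x → Tooth x (toothOf x)
    toothOf-spec {x} bx = select-spec (Tooth x) x (proj₁ (tooth-unique bx))

    -- A neighbour besides `x` would make `t` branch.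
    leaf : ∀ {x t w} → Tooth x t → H [ t ~ w ] → w ≡ x
    leaf {x} {t} {w} (xt , ¬bt) tw with em {P = w ≡ x}
    ... | yes w≡x = w≡x
    ... | no  w≢x = contradiction (w , x , w≢x , tw , Graph.~-sym H xt) ¬bt

    start : ∃[ x ] ∃[ y ] N x y
    start with charted (inhabited em infinite)
    ... | z , C , _ = first z near-centre
      where
      open LocalPredicates 3≤r C
      -- The centre may be a tooth, with its spine vertex one step away. The next spine vertex is
      -- then within distance 2, as `branching⁺` requires.
      edge-from : ∀ i → Near 1 (spine i) → ∃[ x ] ∃[ y ] N x y
      edge-from i ni = chart (spine i) , chart (spine (sucℤ i)) ,
        preserves (weaken 3 ni) (weaken 3 nj) (along (inj₁ refl)) ,
        branching⁺ (weaken 2 ni) (spine-branching _) , branching⁺ nj (spine-branching _)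
        where
        nj : Near 2 (spine (sucℤ i))
        nj = step ni (along (inj₁ refl))
      first : ∀ z → Near 0 z → ∃[ x ] ∃[ y ] N x y
      first (spine i) nz = edge-from i (weaken 1 nz)
      first (tooth i) nz = edge-from i (step nz down)

    f : ℤ → V H
    f = point em line (proj₂ (proj₂ start))

    f-⇄ : ∀ {i j} → i ⇄ j → N (f i) (f j)
    f-⇄ = point-⇄ em line (proj₂ (proj₂ start))

    f-branching : ∀ i → Branching H (f i)
    f-branching i = proj₁ (proj₂ (f-⇄ {i} (inj₁ refl)))

    covering : Covering Comb H
    covering = record
      { cover     = cover
      ; preserves = preserves
      ; lifts     = lifts _
      }
      where
      cover : CombVertex → V H
      cover (spine i) = f i
      cover (tooth i) = toothOf (f i)

      preserves : ∀ {x y} → CombEdge x y → H [ cover x ~ cover y ]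
      preserves {spine i} {spine j} (along i⇄j) = proj₁ (f-⇄ {i} {j} i⇄j)
      preserves {spine i}           up          = proj₁ (toothOf-spec (f-branching i))
      preserves {tooth i}           down        = Graph.~-sym H (proj₁ (toothOf-spec (f-branching i)))

      lifts : ∀ x {w} → H [ cover x ~ w ] → ∃[ y ] (CombEdge x y × cover y ≡ w)
      lifts (tooth i) tw = spine i , down , sym (leaf (toothOf-spec (f-branching i)) tw)
      -- A branching neighbour lies on the line and is lifted there; any other neighbour is the
      -- unique tooth.
      lifts (spine i) {w} fw with em {P = Branching H w}
      ... | yes bw = let (j , i⇄j , eq) = point-lifts em line (proj₂ (proj₂ start)) i (fw , f-branching i , bw)
                     in spine j , along i⇄j , eq
      ... | no ¬bw = tooth i , up ,
        proj₂ (tooth-unique (f-branching i)) (toothOf-spec (f-branching i)) (fw , ¬bw)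

    open Covering covering using (cover; surjective; injective⇒≅)

    rigid : Comb ≅ H
    rigid with injective-or-finite em line (proj₂ (proj₂ start))
    ... | inj₁ f-injective = injective⇒≅ connected (spine (+ 0)) (cover-injective _ _)
      where
      cover-injective : ∀ x y → cover x ≡ cover y → x ≡ y
      cover-injective (spine i) (spine j) eq = cong spine (f-injective eq)
      cover-injective (spine i) (tooth j) eq = contradiction
        (subst (Branching H) eq (f-branching i)) (proj₂ (toothOf-spec (f-branching j)))
      cover-injective (tooth i) (spine j) eq = contradiction
        (subst (Branching H) (sym eq) (f-branching j)) (proj₂ (toothOf-spec (f-branching i)))
      -- A tooth has a single neighbour, so equal teeth hang on equal spine vertices.
      cover-injective (tooth i) (tooth j) eq = cong tooth (f-injective (leaf
        (subst (Tooth (f j)) (sym eq) (toothOf-spec (f-branching j)))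
        (Graph.~-sym H (proj₁ (toothOf-spec (f-branching i))))))
    -- The listed spine vertices and their teeth would exhaust `H`.
    ... | inj₂ (xs , covers) = contradiction
      (let (d , _ , H↔Fin) = covered⇒finite em (xs ++ map toothOf xs) member in d , H↔Fin) infinite
      where
      member : ∀ w → w ∈ xs ++ map toothOf xs
      member w with surjective connected (spine (+ 0)) w
      ... | spine i , refl with (_ , x∈xs , refl) ← covers i = ∈-++⁺ˡ x∈xs
      ... | tooth i , refl with (x , x∈xs , eq) ← covers i =
        ∈-++⁺ʳ xs (subst (λ y → toothOf y ∈ map toothOf xs) (sym eq) (∈-map⁺ toothOf x∈xs))

  -- Rigidity of the ladder

  module LadderRigid {r} (3≤r : 3 ≤ r) (H : Graph)
    (connected : Connected H) (infinite : Infinite (V H))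
    (charted : ∀ v → ∃[ z ] (Σ (Chart r Ladder z H) λ C → Chart.chart C z ≡ v)) where

    module Local {z} (C : Chart r Ladder z H) where
      open LocalPredicates 3≤r C public

      lift-rung : ∀ {i b w} → Near 1 (i , b) → Rung H (chart (i , b)) w →
                  ∃[ b′ ] (b ≢ b′ × Near 2 (i , b′) × chart (i , b′) ≡ w)
      lift-rung n rg@(xw , _)
        with (y , xy , ny , refl) ← lift n xw
        with (b′ , b≢b′ , refl) ← rung-inversion (rung⁻ n xy rg)
        = b′ , b≢b′ , ny , refl

      lift-rail : ∀ {i b w} → Near 1 (i , b) → Rail H (chart (i , b)) w →
                  ∃[ j ] (i ⇄ j × Near 2 (j , b) × chart (j , b) ≡ w)
      lift-rail n rl@(xw , _)
        with (y , xy , ny , refl) ← lift n xw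
        with (j , i⇄j , refl) ← rail-inversion (rail⁻ n xy rl)
        = j , i⇄j , ny , refl

    rung-exists : ∀ x → Satisfiable (Rung H x)
    rung-exists x with charted x
    ... | (i , b) , C , refl =
      _ , rung⁺ near-centre (ladder-rung (not-¬ {b} refl))
      where open Local C

    rung-unique : ∀ {x y z} → Rung H x y → Rung H x z → y ≡ z
    rung-unique {x} xy xz with charted x
    ... | (i , b) , C , refl
      with (_ , p , _ , refl) ← Local.lift-rung C (Local.near-centre C) xy
      with (_ , q , _ , refl) ← Local.lift-rung C (Local.near-centre C) xz
      = cong (λ b′ → Local.chart C (i , b′)) (≢-unique p q)

    -- The definition of `Rung` treats the two ends differently; the symmetry is read off in a
    -- chart, where rungs are those of the ladder.
    rung-sym : Symmetric (Rung H)
    rung-sym {x} xy with charted x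
    ... | (i , b) , C , refl
      with (b′ , p , _ , refl) ← Local.lift-rung C (Local.near-centre C) xy
      = rung⁺ (step near-centre (rung p)) (ladder-rung (p ∘ sym))
      where open Local C

    rail-sym : Symmetric (Rail H)
    rail-sym (xy , ¬rung) = Graph.~-sym H xy , ¬rung ∘ rung-sym

    rung-irrefl : ∀ {x} → ¬ Rung H x x
    rung-irrefl (xx , _) = Graph.~-irr H refl xx

    -- Collapsing rungs makes a rail that comes back on the other side, as in a Möbius ladder, count
    -- as repeating.
    _≈_ : Rel (V H) 0ℓ
    x ≈ y = x ≡ y ⊎ Rung H x y

    ≈-isEquivalence : IsEquivalence _≈_
    ≈-isEquivalence = record
      { refl  = inj₁ refl
      ; sym   = λ where
          (inj₁ refl) → inj₁ refl
          (inj₂ xy)   → inj₂ (rung-sym xy)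
      ; trans = λ where
          (inj₁ refl) q           → q
          (inj₂ xy)   (inj₁ refl) → inj₂ xy
          (inj₂ xy)   (inj₂ yz)   → inj₁ (rung-unique (rung-sym xy) yz)
      }

    continue : ∀ {x y} → Rail H x y →
               ∃[ z ] (Rail H y z × z ≢ x × (∀ {w} → Rail H y w → w ≢ x → w ≡ z))
    continue {x} {y} xy with charted y
    ... | (i , b) , C , refl
      with (j , i⇄j , nj , refl) ← Local.lift-rail C (Local.near-centre C) (rail-sym xy)
      with (k , i⇄k , k≢j , unique) ← opposite i⇄j
      = chart (k , b) , rail⁺ n (ladder-rail i⇄k) ,
        (λ eq → k≢j (cong proj₁ (injective (weaken 3 (step n (rail i⇄k))) (weaken 3 nj) eq))) ,
        λ yw w≢x → case lift-rail n yw of λ where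
          (l , i⇄l , _ , refl) → cong (λ l → chart (l , b)) (unique i⇄l λ where refl → w≢x refl)
      where
      open Local C
      n : Near 1 (i , b)
      n = near-centre

    -- In a chart at `y` both rail neighbours lie on the same side, whereas a rung changes sides.
    fork : ∀ {x y z} → Rail H y x → Rail H y z → x ≢ z → ¬ x ≈ z
    fork _ _ x≢z (inj₁ x≡z) = x≢z x≡z
    fork {y = y} yx yz _ (inj₂ xz) with charted y
    ... | (i , b) , C , refl
      with (j , i⇄j , _ , refl) ← Local.lift-rail C (Local.near-centre C) yx
      with (k , i⇄k , nk , refl) ← Local.lift-rail C (Local.near-centre C) yz
      with (b′ , b≢b′ , nb , eq) ← Local.lift-rung C (Local.step C (Local.near-centre C) (rail i⇄j)) xz
      = b≢b′ (sym (cong proj₂ (Local.injective C (Local.weaken C 3 nb) (Local.weaken C 3 nk) eq)))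

    transport : ∀ {x x′ y y′ z} → Rail H x y → Rail H x z → y ≢ z → x ≈ x′ → Rail H x′ y′ →
                y′ ≈ y ⊎ y′ ≈ z
    transport {y = y} {y′ = y′} xy xz y≢z (inj₁ refl) xy′ with em {P = y′ ≡ y}
    ... | yes y′≡y = inj₁ (inj₁ y′≡y)
    ... | no  y′≢y = let (_ , _ , _ , unique) = continue (rail-sym xy)
                     in inj₂ (inj₁ (trans (unique xy′ y′≢y) (sym (unique xz (y≢z ∘ sym)))))
    -- Across the rung, `y′` sits at a position `l` adjacent to `i`. So `l` is `j` or `k`, and the
    -- rung at that position gives the equivalence.
    transport {x} xy xz y≢z (inj₂ xx′) x′y′ with charted x
    ... | (i , b) , C , refl
      with (j , i⇄j , _ , refl) ← Local.lift-rail C (Local.near-centre C) xy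
      with (k , i⇄k , _ , refl) ← Local.lift-rail C (Local.near-centre C) xz
      with (b′ , b≢b′ , _ , refl) ← Local.lift-rung C (Local.near-centre C) xx′
      with (l , i⇄l , _ , refl) ← Local.lift-rail C (Local.step C (Local.near-centre C) (rung b≢b′)) x′y′
      with em {P = l ≡ j}
    ... | yes refl = inj₁ (inj₂ (rung-sym (rung⁺ (step near-centre (rail i⇄l)) (ladder-rung b≢b′))))
      where open Local C
    ... | no l≢j with (_ , _ , _ , unique) ← opposite i⇄j
      with refl ← trans (unique i⇄l l≢j) (sym (unique i⇄k λ where refl → y≢z refl))
      = inj₂ (inj₂ (rung-sym (rung⁺ (step near-centre (rail i⇄k)) (ladder-rung b≢b′))))
      where open Local C

    rail-across : ∀ {x x′ y y′} → Rail H x y → Rung H x x′ → Rung H y y′ → Rail H x′ y′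
    rail-across {x} xy xx′ yy′ with charted x
    ... | (i , b) , C , refl
      with (j , i⇄j , _ , refl) ← Local.lift-rail C (Local.near-centre C) xy
      with (b′ , b≢b′ , _ , refl) ← Local.lift-rung C (Local.near-centre C) xx′
      with (b″ , b≢b″ , _ , refl) ← Local.lift-rung C (Local.step C (Local.near-centre C) (rail i⇄j)) yy′
      with refl ← ≢-unique b≢b′ b≢b″
      = rail⁺ (step near-centre (rung b≢b′)) (ladder-rail i⇄j)
      where open Local C

    line : IsLine _≈_ (Rail H)
    line = record
      { isEquivalence = ≈-isEquivalence
      ; N-sym         = rail-sym
      ; continue      = continue
      ; N⇒≉           = λ where
          (xx , _)    (inj₁ refl) → Graph.~-irr H refl xx
          (_ , ¬rung) (inj₂ rg)   → ¬rung rg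
      ; fork          = fork
      ; transport     = transport
      }

    partner : V H → V H
    partner x = proj₁ (rung-exists x)

    partner-rung : ∀ x → Rung H x (partner x)
    partner-rung x = proj₂ (rung-exists x)

    -- Unfolding this in the conversion checks about f below is very expensive.
    abstract
      start : ∃[ x ] ∃[ y ] Rail H x y
      start with charted (inhabited em infinite)
      ... | z , C , _ = _ , _ , rail⁺ near-centre (ladder-rail (inj₁ refl))
        where open Local C

    f : ℤ → V H
    f = point em line (proj₂ (proj₂ start))

    f-⇄ : ∀ {i j} → i ⇄ j → Rail H (f i) (f j)
    f-⇄ = point-⇄ em line (proj₂ (proj₂ start))

    cover : ℤ × Bool → V H
    cover (i , false) = f i
    cover (i , true)  = partner (f i)

    cover-rung : ∀ i {b b′} → b ≢ b′ → Rung H (cover (i , b)) (cover (i , b′))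
    cover-rung i {false} {false} b≢b = contradiction refl b≢b
    cover-rung i {false} {true}  _   = partner-rung (f i)
    cover-rung i {true}  {false} _   = rung-sym (partner-rung (f i))
    cover-rung i {true}  {true}  b≢b = contradiction refl b≢b

    cover-rail : ∀ {i j} b → i ⇄ j → Rail H (cover (i , b)) (cover (j , b))
    cover-rail {i} {j} false i⇄j = f-⇄ {i} {j} i⇄j
    cover-rail {i} {j} true  i⇄j =
      rail-across (f-⇄ {i} {j} i⇄j) (partner-rung (f i)) (partner-rung (f j))

    lift-rail : ∀ i b {w} → Rail H (cover (i , b)) w → ∃[ j ] (i ⇄ j × cover (j , b) ≡ w)
    lift-rail i false fw = point-lifts em line (proj₂ (proj₂ start)) i fw
    lift-rail i true {w} pw =
      -- The rail edge is carried over the rungs to the side traced by `f`, lifted there, and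
      -- carried back.
      let (j , i⇄j , eq) = lift-rail i false
            (rail-across pw (rung-sym (partner-rung (f i))) (partner-rung w))
      in j , i⇄j , rung-unique (partner-rung (f j))
                     (subst (λ x → Rung H x w) (sym eq) (rung-sym (partner-rung w)))

    covering : Covering Ladder H
    covering = record
      { cover     = cover
      ; preserves = λ where
          (rail {b = b} i⇄j)  → proj₁ (cover-rail b i⇄j)
          {i , _} (rung b≢b′) → proj₁ (cover-rung i b≢b′)
      ; lifts     = λ {(i , b)} {w} xw → case em {P = Rung H (cover (i , b)) w} of λ where
          (yes rg) → (i , not b) , rung (not-¬ {b} refl) ,
                     rung-unique (cover-rung i (not-¬ {b} refl)) rg
          (no ¬rg) → let (j , i⇄j , eq) = lift-rail i b (xw , ¬rg)
                     in (j , b) , rail i⇄j , eq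
      }

    open Covering covering using (surjective; injective⇒≅)
    open IsEquivalence ≈-isEquivalence using () renaming (sym to ≈-sym; trans to ≈-trans)

    cover≈f : ∀ i b → cover (i , b) ≈ f i
    cover≈f i false = inj₁ refl
    cover≈f i true  = inj₂ (rung-sym (partner-rung (f i)))

    rigid : Ladder ≅ H
    rigid with injective-or-finite em line (proj₂ (proj₂ start))
    ... | inj₁ f-injective = injective⇒≅ connected (+ 0 , false) λ {x} {y} → cover-injective x y
      where
      cover-injective : ∀ x y → cover x ≡ cover y → x ≡ y
      -- Up to rungs both images lie on `f`, which makes the positions equal. Different sides would
      -- then give a rung from a vertex to itself.
      cover-injective (i , b) (j , b′) eq
        with refl ← f-injective {i} {j}
                      (≈-trans (≈-sym (cover≈f i b)) (≈-trans (inj₁ eq) (cover≈f j b′)))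
        with em {P = b ≡ b′}
      ... | yes refl = refl
      ... | no  b≢b′ = contradiction (subst (Rung H _) (sym eq) (cover-rung i b≢b′)) rung-irrefl
    ... | inj₂ (xs , covers) = contradiction
      (let (d , _ , H↔Fin) = covered⇒finite em (xs ++ map partner xs) member in d , H↔Fin) infinite
      where
      member : ∀ w → w ∈ xs ++ map partner xs
      member w
        with ((i , b) , refl) ← surjective connected (+ 0 , false) w
        with (x , x∈xs , f≈x) ← covers i
        -- The class of the listed `x` consists of `x` and its partner.
        with ≈-trans (cover≈f i b) f≈x
      ... | inj₁ w≡x = ∈-++⁺ˡ (subst (_∈ xs) (sym w≡x) x∈xs)
      ... | inj₂ wx  = ∈-++⁺ʳ xs (subst (_∈ map partner xs)
        (rung-unique (partner-rung x) (rung-sym wx)) (∈-map⁺ partner x∈xs))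

-- Connectedness, infinity and degrees of the two graphs

-ₑ-reachable : (G : Graph) (e : Edge G) → ∀ {x y} → G [ x ~ y ] → ¬ Joins e x y →
               Reachable (G -ₑ e) x y
-ₑ-reachable G e xy ¬J = edge⇒reachable {G -ₑ e} (xy , ¬J)

comb-spine : ∀ i j → Reachable Comb (spine i) (spine j)
comb-spine i = ℤ-induction (λ j → Reachable Comb (spine i) (spine j))
  (λ _ ij → Reachable-trans ij (edge⇒reachable (along (inj₁ refl))))
  (λ _ ij → Reachable-trans ij (edge⇒reachable (along (inj₂ refl))))
  (0 , [])

comb-connected : Connected Comb
comb-connected x y = Reachable-trans (toSpine x)
  (Reachable-trans (comb-spine _ _) (Reachable-sym (toSpine y)))
  where
  index-of : CombVertex → ℤ
  index-of (spine i) = i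
  index-of (tooth i) = i
  toSpine : ∀ x → Reachable Comb x (spine (index-of x))
  toSpine (spine i) = 0 , []
  toSpine (tooth i) = edge⇒reachable down

comb-infinite : Infinite CombVertex
comb-infinite = injection⇒infinite (spine ∘ +_) λ where refl → refl

ladder-connected : Connected Ladder
ladder-connected (i , b) (j , b′) = Reachable-trans
  (ℤ-induction (λ j → Reachable Ladder (i , b) (j , b))
    (λ _ ij → Reachable-trans ij (edge⇒reachable (rail (inj₁ refl))))
    (λ _ ij → Reachable-trans ij (edge⇒reachable (rail (inj₂ refl))))
    (0 , []) j)
  (across b b′)
  where
  across : ∀ b b′ → Reachable Ladder (j , b) (j , b′)
  across false false = 0 , []
  across false true  = edge⇒reachable (rung λ ())
  across true  false = edge⇒reachable (rung λ ())
  across true  true  = 0 , []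

ladder-infinite : Infinite (ℤ × Bool)
ladder-infinite = injection⇒infinite (λ n → + n , false) λ where refl → refl

⇄-cases : ∀ {i j} → i ⇄ j → j ≡ sucℤ i ⊎ j ≡ pred i
⇄-cases (inj₁ p)    = inj₁ p
⇄-cases (inj₂ refl) = inj₂ (sym (ℤ.pred-suc _))

i⇄pred[i] : ∀ i → i ⇄ pred i
i⇄pred[i] i = inj₂ (sym (ℤ.suc-pred i))

-- The spine edge joins -1 to 0, so that its two sides are the two constructors of `ℤ`.
spine-edge tooth-edge : Edge Comb
spine-edge = record { src = spine -[1+ 0 ] ; tgt = spine (+ 0) ; adj = along (inj₁ refl) }
tooth-edge = record { src = tooth (+ 0) ; tgt = spine (+ 0) ; adj = down }

module _ (em : ExcludedMiddle 0ℓ) where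

  degree≤ : ∀ (G : Graph) v (xs : List [ w ∈ V G ∣ G [ v ~ w ] ]) →
            (∀ {w} (e : G [ v ~ w ]) → (w ∣ᵣ [ e ]) ∈ xs) →
            ∃[ d ] (d ≤ length xs × ([ w ∈ V G ∣ G [ v ~ w ] ] ↔ Fin d))
  degree≤ G v xs covers = covered⇒finite em xs λ (w ∣ᵣ [ e ]) → covers (recompute em e)

  comb-maxDegree : MaxDegree≤ 3 Comb
  comb-maxDegree (spine i) = degree≤ Comb (spine i)
    ((spine (sucℤ i) ∣ᵣ [ along (inj₁ refl) ]) ∷
     (spine (pred i) ∣ᵣ [ along (i⇄pred[i] i) ]) ∷
     (tooth i ∣ᵣ [ up ]) ∷ [])
    λ where
      up        → there (there (here refl))
      (along p) → case ⇄-cases p of λ where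
        (inj₁ refl) → here refl
        (inj₂ refl) → there (here refl)
  comb-maxDegree (tooth i) =
    let (d , d≤1 , bij) = degree≤ Comb (tooth i) ((spine i ∣ᵣ [ down ]) ∷ []) λ where down → here refl
    in d , ℕ.≤-trans d≤1 (s≤s z≤n) , bij

  ladder-maxDegree : MaxDegree≤ 3 Ladder
  ladder-maxDegree (i , b) = degree≤ Ladder (i , b)
    (((sucℤ i , b) ∣ᵣ [ rail (inj₁ refl) ]) ∷
     ((pred i , b) ∣ᵣ [ rail (i⇄pred[i] i) ]) ∷
     ((i , not b) ∣ᵣ [ rung (not-¬ refl) ]) ∷ [])
    λ where
      (rung p) → there (there (here (value-injective (cong (i ,_) (≢-unique p (not-¬ refl))))))
      (rail p) → case ⇄-cases p of λ where
        (inj₁ refl) → here refl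
        (inj₂ refl) → there (here refl)

  MaxDegree≤-weaken : ∀ {G D E} → D ≤ E → MaxDegree≤ D G → MaxDegree≤ E G
  MaxDegree≤-weaken D≤E deg v = let (d , d≤D , bij) = deg v in d , ℕ.≤-trans d≤D D≤E , bij

  comb ladder : ∀ {D} → D ≥ 3 → InfiniteGraph D
  comb D≥3 = record
    { graph     = Comb
    ; connected = comb-connected
    ; infinite  = comb-infinite
    ; maxDegree = MaxDegree≤-weaken {Comb} D≥3 comb-maxDegree
    }
  ladder D≥3 = record
    { graph     = Ladder
    ; connected = ladder-connected
    ; infinite  = ladder-infinite
    ; maxDegree = MaxDegree≤-weaken {Ladder} D≥3 ladder-maxDegree
    }

  comb-isolated : ∀ {D} (D≥3 : D ≥ 3) (S : Subset (𝔊∞≤ D)) → Subset.mem S (comb D≥3) → ¬ Meager S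
  comb-isolated D≥3 = Isolated.not-meager em (comb D≥3) λ 3≤r H balls →
    CombRigid.rigid em 3≤r ⌊ H ⌋ (InfiniteGraph.connected H) (InfiniteGraph.infinite H) λ v →
      let (z , ball) = balls v in z , ball-chart em ball

  ladder-isolated : ∀ {D} (D≥3 : D ≥ 3) (S : Subset (𝔊∞≤ D)) → Subset.mem S (ladder D≥3) → ¬ Meager S
  ladder-isolated D≥3 = Isolated.not-meager em (ladder D≥3) λ 3≤r H balls →
    LadderRigid.rigid em 3≤r ⌊ H ⌋ (InfiniteGraph.connected H) (InfiniteGraph.infinite H) λ v →
      let (z , ball) = balls v in z , ball-chart em ball

  -- Bridges of the two graphs

  detour⇒connected : ∀ {G} (e : Edge G) → Connected G →
                     Reachable (G -ₑ e) (Edge.src e) (Edge.tgt e) → Connected (G -ₑ e)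
  detour⇒connected {G} e connected detour x y = reroute (proj₂ (connected x y))
    where
    bypass : ∀ {x y} → G [ x ~ y ] → Reachable (G -ₑ e) x y
    bypass {x} {y} xy with em {P = Joins e x y}
    ... | yes (inj₁ (refl , refl)) = detour
    ... | yes (inj₂ (refl , refl)) = Reachable-sym {G -ₑ e} detour
    ... | no ¬J                    = -ₑ-reachable G e xy ¬J
    reroute : ∀ {n x y} → Walk G n x y → Reachable (G -ₑ e) x y
    reroute []      = 0 , []
    reroute (s ∷ w) = Reachable-trans {G -ₑ e} (bypass s) (reroute w)

  ladder-bridgeless : Bridgeless Ladder
  ladder-bridgeless (e@record { adj = adj } , bridge) =
    bridge (detour⇒connected e ladder-connected (detour adj))
    where
    detour : ∀ {x y} (adj : LadderEdge x y) →
             Reachable (Ladder -ₑ record { src = x ; tgt = y ; adj = adj }) x y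
    -- The other three sides of the 4-cycle on this rail edge; each has an end on the opposite rail,
    -- so none is the deleted edge.
    detour {i , b} {j , b} s@(rail i⇄j) = 3 ,
      ((rung b≢b′ , λ where
          (inj₁ (_ , eq)) → b≢b′ (sym (cong proj₂ eq))
          (inj₂ (_ , eq)) → b≢b′ (sym (cong proj₂ eq))) ∷
       (rail i⇄j , λ where
          (inj₁ (eq , _)) → b≢b′ (sym (cong proj₂ eq))
          (inj₂ (eq , _)) → b≢b′ (sym (cong proj₂ eq))) ∷
       (rung (b≢b′ ∘ sym) , λ where
          (inj₁ (eq , _)) → b≢b′ (sym (cong proj₂ eq))
          (inj₂ (eq , _)) → b≢b′ (sym (cong proj₂ eq))) ∷ [])
      where
      b≢b′ : b ≢ not b
      b≢b′ = not-¬ refl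
    -- Here the 4-cycle reaches to position `sucℤ i`, and each of the three sides has an end there.
    detour {i , b} {i , b′} (rung b≢b′) = 3 ,
      ((rail (inj₁ refl) , λ where
          (inj₁ (_ , eq)) → ℤ.i≢suc[i] (sym (cong proj₁ eq))
          (inj₂ (_ , eq)) → ℤ.i≢suc[i] (sym (cong proj₁ eq))) ∷
       (rung b≢b′ , λ where
          (inj₁ (eq , _)) → ℤ.i≢suc[i] (sym (cong proj₁ eq))
          (inj₂ (eq , _)) → ℤ.i≢suc[i] (sym (cong proj₁ eq))) ∷
       (rail (inj₂ refl) , λ where
          (inj₁ (eq , _)) → ℤ.i≢suc[i] (sym (cong proj₁ eq))
          (inj₂ (eq , _)) → ℤ.i≢suc[i] (sym (cong proj₁ eq))) ∷ [])

  -- Deleting its only edge isolates the tooth, whose component is then a single vertex.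
  comb-oneWay : HasOneWayInfiniteBridge Comb
  comb-oneWay = tooth-edge , bridge , λ (_ , infinite) → infinite (tooth (+ 0)) finite
    where
    stuck : ∀ {n y} → Walk (Comb -ₑ tooth-edge) n (tooth (+ 0)) y → y ≡ tooth (+ 0)
    stuck []                = refl
    stuck ((down , ¬J) ∷ _) = contradiction (inj₁ (refl , refl)) ¬J

    bridge : IsBridge Comb tooth-edge
    bridge connected with () ← stuck (proj₂ (connected (tooth (+ 0)) (spine (+ 0))))

    finite : Finite (Component (Comb -ₑ tooth-edge) (tooth (+ 0)))
    finite =
      let (d , _ , bij) = covered⇒finite em ((tooth (+ 0) ∣ᵣ [ (0 , []) ]) ∷ []) λ (y ∣ᵣ [ r ]) →
            here (value-injective (stuck (proj₂ (recompute em r))))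
      in d , bij

comb-twoWay : HasTwoWayInfiniteBridge Comb
comb-twoWay = spine-edge , bridge , infinite
  where
  K : Graph
  K = Comb -ₑ spine-edge

  -- The side of the deleted edge, an invariant of walks in `K`.
  NonNegative : CombVertex → Bool
  NonNegative (spine (+ _))    = true
  NonNegative (spine -[1+ _ ]) = false
  NonNegative (tooth (+ _))    = true
  NonNegative (tooth -[1+ _ ]) = false

  upwards : ∀ i → ¬ Joins spine-edge (spine i) (spine (sucℤ i)) →
            NonNegative (spine i) ≡ NonNegative (spine (sucℤ i))
  upwards (+ n)        _  = refl
  upwards -[1+ zero ]  ¬J = contradiction (inj₁ (refl , refl)) ¬J
  upwards -[1+ suc n ] _  = refl

  same-side : ∀ {x y} → K [ x ~ y ] → NonNegative x ≡ NonNegative y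
  same-side (along (inj₁ refl) , ¬J)        = upwards _ ¬J
  same-side (along {j = j} (inj₂ refl) , ¬J) = sym (upwards j (¬J ∘ λ where
    (inj₁ (p , q)) → inj₂ (q , p)
    (inj₂ (p , q)) → inj₁ (q , p)))
  same-side {spine (+ _)}    (up , _)   = refl
  same-side {spine -[1+ _ ]} (up , _)   = refl
  same-side {tooth (+ _)}    (down , _) = refl
  same-side {tooth -[1+ _ ]} (down , _) = refl

  walk-side : ∀ {n x y} → Walk K n x y → NonNegative x ≡ NonNegative y
  walk-side []      = refl
  walk-side (e ∷ w) = trans (same-side e) (walk-side w)

  bridge : IsBridge Comb spine-edge
  bridge connected with () ← walk-side (proj₂ (connected (spine -[1+ 0 ]) (spine (+ 0))))

  right : ∀ n → Reachable K (spine (+ 0)) (spine (+ n))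
  right zero    = 0 , []
  right (suc n) = Reachable-trans {K} (right n)
    (-ₑ-reachable Comb spine-edge (along (inj₁ refl)) λ where
      (inj₁ (() , _))
      (inj₂ (_ , ())))

  left : ∀ n → Reachable K (spine -[1+ 0 ]) (spine -[1+ n ])
  left zero    = 0 , []
  left (suc n) = Reachable-trans {K} (left n)
    (-ₑ-reachable Comb spine-edge (along (inj₂ refl)) λ where
      (inj₁ (_ , ()))
      (inj₂ (() , _)))

  -- The ray of the spine on the side of `i` avoids the deleted edge, so it lies in the component.
  spine-component-infinite : ∀ x i → Reachable K x (spine i) → Infinite (Component K x)
  spine-component-infinite x (+ n) r = injection⇒infinite
    (λ m → spine (+ m) ∣ᵣ [ Reachable-trans {K} r (Reachable-trans {K} (Reachable-sym {K} (right n)) (right m)) ])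
    λ where refl → refl
  spine-component-infinite x -[1+ n ] r = injection⇒infinite
    (λ m → spine -[1+ m ] ∣ᵣ [ Reachable-trans {K} r (Reachable-trans {K} (Reachable-sym {K} (left n)) (left m)) ])
    λ where refl → refl

  infinite : AllComponentsInfinite K
  infinite (spine i) = spine-component-infinite (spine i) i (0 , [])
  infinite (tooth i) = spine-component-infinite (tooth i) i
    (-ₑ-reachable Comb spine-edge down λ where
      (inj₁ (() , _))
      (inj₂ (() , _)))

theorem4p17 : (∀ {ℓ} → ExcludedMiddle ℓ) →
    (∀ D → D ≥ 3 →
    ¬ Meager (oneWayInfiniteBridgeGraphs D) × ¬ Comeager (oneWayInfiniteBridgeGraphs D)) ×
    (∀ D → D ≥ 3 →
    ¬ Meager (twoWayInfiniteBridgeGraphs D) × ¬ Comeager (twoWayInfiniteBridgeGraphs D)) ×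
    (∀ D → D ≥ 4 →
    ¬ Meager (bridgelessGraphs D) × ¬ Comeager (bridgelessGraphs D))
theorem4p17 em =
  (λ D D≥3 →
    comb-isolated em D≥3 (oneWayInfiniteBridgeGraphs D) (comb-oneWay em) ,
    ladder-isolated em D≥3 (complement (oneWayInfiniteBridgeGraphs D))
      λ (e , bridge , _) → ladder-bridgeless em (e , bridge)) ,
  (λ D D≥3 →
    comb-isolated em D≥3 (twoWayInfiniteBridgeGraphs D) comb-twoWay ,
    ladder-isolated em D≥3 (complement (twoWayInfiniteBridgeGraphs D))
      λ (e , bridge , _) → ladder-bridgeless em (e , bridge)) ,
  -- The roles are swapped: the ladder lies in the set and the comb in its complement.
  (λ D D≥4 →
    ladder-isolated em (ℕ.<⇒≤ D≥4) (bridgelessGraphs D) (ladder-bridgeless em) ,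
    comb-isolated em (ℕ.<⇒≤ D≥4) (complement (bridgelessGraphs D))
      λ bridgeless → let (e , bridge , _) = comb-twoWay in bridgeless (e , bridge))
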